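{- Let $p>3$ be a prime and let $m\in\mathbb{Z}_p$ with $m(m-16)(m-256)\not\equiv 0 \pmod p$. Then $$\sum_{k=0}^{(p-1)/2}\frac{\binom{2k}k^3}{m^k} \equiv \Big(\frac {m(m-16)}p\Big)\sum_{k=0}^{\lfloor p/6\rfloor}\binom{2k}k\binom{3k}k\binom{6k}{3k} \Big(\frac m{(m-16)^3}\Big)^k \equiv \Big(\frac {m(m-256)}p\Big)\sum_{k=0}^{\lfloor p/6\rfloor}\binom{2k}k\binom{3k}k\binom{6k}{3k} \Big(\frac {m^2}{(256-m)^3}\Big)^k \pmod p.$$
   Context: For a prime $p$, $\mathbb{Z}_p$ denotes the set of rational numbers whose denominator is not divisible by $p$; congruences modulo $p$ are taken in $\mathbb{Z}_p$. For $a\in\mathbb{Z}_p$, $\big(\frac ap\big)$ is the Legendre symbol of $a$ (i.e. of any integer congruent to $a$ modulo $p$). $\lfloor x\rfloor$ is the greatest integer not exceeding $x$. -}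

module Defs where

open import Data.Nat as ℕ using (ℕ; zero; suc)
open import Data.Nat.Divisibility using (_∣_; _∣?_)
open import Data.Integer as ℤ using (ℤ; +_; -[1+_])
open import Data.Rational as ℚ using (ℚ; ↥_; ↧ₙ_; 0ℚ; 1ℚ; _+_; _*_; _-_; 1/_)
open import Data.Rational.Properties using (_≟_)
open import Data.Fin using (Fin; toℕ)
open import Data.Fin.Properties using (any?)
open import Data.Product using (∃)
open import Relation.Nullary using (Dec; yes; no; ¬_)

ℕtoℚ : ℕ → ℚ
ℕtoℚ n = (+ n) ℚ./ 1

ℤtoℚ : ℤ → ℚ
ℤtoℚ z = z ℚ./ 1

pow : ℚ → ℕ → ℚ
pow q zero = 1ℚ
pow q (suc k) = q * pow q k

-- total inverse: 1/q for q ≠ 0 (only ever applied to nonzero arguments below)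
inv : ℚ → ℚ
inv q with q ≟ 0ℚ
... | yes _ = 0ℚ
... | no q≢0 = 1/_ q {{ℚ.≢-nonZero q≢0}}

-- q ∈ ℤ_p : the denominator of q (in lowest terms) is not divisible by p
InZp : ℕ → ℚ → Set
InZp p q = ¬ (p ∣ ↧ₙ q)

-- p divides q in ℤ_p (q ∈ pℤ_p): p divides the numerator of q in lowest terms
DivZp : ℕ → ℚ → Set
DivZp p q = p ∣ ℤ.∣ ↥ q ∣

infix 4 _≡_[modℚ_]
_≡_[modℚ_] : ℚ → ℚ → ℕ → Set
x ≡ y [modℚ p ] = DivZp p (x - y)

legendre : ℚ → ℕ → ℤ
legendre a p with p ∣? ℤ.∣ ↥ a ∣
... | yes _ = + 0
... | no _ with any? {n = p} (λ (x : Fin p) → p ∣? ℤ.∣ ↥ (ℕtoℚ (toℕ x) * ℕtoℚ (toℕ x) - a) ∣)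
...   | yes _ = + 1
...   | no _ = -[1+ 0 ]

sumTo : ℕ → (ℕ → ℚ) → ℚ
sumTo zero f = f 0
sumTo (suc n) f = sumTo n f + f (suc n)

{-# OPTIONS --safe #-}
module Submission where

-- Modulo p = 2N + 1 the number N is −1/2 and (1 − cx)^N is a Legendre symbol, so with x = 1/m both
-- congruences reduce to polynomial congruences in x: the sum of C(2n,n)³ xⁿ over n ≤ N equals
-- the sum over k ≤ p/6 of C(2k,k) C(3k,k) C(6k,3k) times x^(2k) (1 − 16x)^(N−3k), respectively times
-- (−x)^k (1 − 256x)^(N−3k); the terms with k > p/6 vanish modulo p.  Comparing coefficients,
-- and replacing N by −1/2, these become two instances of the Pfaff–Saalschütz summation
-- ₃F₂(−n/2, (1−n)/2, n+1/2; 1, 1; 1) and ₃F₂(−n, n/2+1/4, n/2+3/4; 1, 1; 1).  Both sums over k obey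
-- (n+1)³ S(n+1) = 8 (2n+1)³ S(n), the recurrence of C(2n,n)³, by creative telescoping.

-- The obstacle is division. The summations carry j! k!³ in their denominators and rising factorials
-- of 1/2. The factorials are cleared by `e`, at the cost of an overall N!⁴; the rising factorials
-- become odd products, (1/2)_s = `δ s` / 2ˢ. The closed forms are then exact integer identities for
-- every n ≤ N. Reduction modulo p comes only afterwards, when N!⁴, a unit modulo p, is cancelled.
-- The exponent N - 3k comes from the cubes in the arguments: with u = 1 - cx and y one of
-- m/(m-16)³, m²/(256-m)³, the product y u³ is x², respectively -x, so yᵏ u^N is x^(2k),
-- respectively (-x)ᵏ, times u^(N-3k). The constants: `B` = c/2 is 8 or 128, because B^j δ(3k+j) ≡
-- δ(3k) j! C(N-3k, j) (-2B)^j; the 8 in `A` = ±8 comes from C(2k,k) C(3k,k) C(6k,3k) = 8ᵏ δ(3k) /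
-- k!³.

module Transformations where

  open import Defs
  open import Algebra.Bundles using (CommutativeMonoid)
  import Algebra.Properties.CommutativeSemigroup as CommutativeSemigroup
  open import Data.Empty using (⊥-elim)
  import Data.Empty.Irrelevant as Irrelevant
  open import Data.Fin using (Fin; toℕ; fromℕ<)
  open import Data.Fin.Properties using (any?; toℕ-fromℕ<)
  open import Data.Integer as ℤ using (ℤ; +_; -[1+_]; _+_; _*_; _-_; -_; _^_)
  import Data.Integer.Divisibility.Signed as Signed
  import Data.Integer.Properties as ℤ
  open import Data.Integer.Tactic.RingSolver using (solve-∀)
  open import Data.Nat as ℕ using (ℕ; zero; suc; _≤_; _<_; z≤n; s≤s; _!; nonTrivial⇒n>1)
  open import Data.Nat.Combinatorics using (_C_; nCk≡n!/k![n-k]!; k![n∸k]!∣n!; nCk+nC[k+1]≡[n+1]C[k+1]; k>n⇒nCk≡0; nCn≡1)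
  open import Data.Nat.Divisibility using (_∣_; _∣?_; divides; ∣-refl; >⇒∤)
  open import Data.Nat.DivMod using (m/n*n≡m; m≡m%n+[m/n]*n; m%n<n; m/n*n≤m; m*n/n≡m; /-monoˡ-≤)
  open import Data.Nat.Primality using (Prime; euclidsLemma; prime⇒nonZero; prime⇒nonTrivial; prime⇒irreducible)
  import Data.Nat.Properties as ℕ
  open import Data.Nat.Properties using (_!≢0; _!*_!≢0)
  import Data.Nat.Tactic.RingSolver as ℕ-Ring
  open import Data.Product using (_×_; _,_; ∃; proj₁; proj₂)
  open import Data.Rational as ℚ using (ℚ; mkℚ; 0ℚ; 1ℚ; ↥_; ↧_; ↧ₙ_; toℚᵘ)
  import Data.Rational.Properties as ℚ
  import Data.Rational.Unnormalised as ℚᵘ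
  import Data.Rational.Unnormalised.Properties as ℚᵘ
  open import Data.Sum as Sum using (_⊎_; inj₁; inj₂)
  open import Data.Vec as Vec using (Vec; []; _∷_)
  open import Function using (_∘_; id)
  open import Level using (0ℓ)
  open import Relation.Binary.Bundles using (Setoid)
  open import Relation.Binary.Definitions using (tri<; tri≈; tri>)
  open import Relation.Binary.PropositionalEquality
  import Relation.Binary.Reasoning.Setoid
  open import Relation.Nullary using (¬_; yes; no)

  -- Finite sums, shifted sequences and the polynomial identities behind the telescoping.

  ∑ : ℕ → (ℕ → ℤ) → ℤ
  ∑ zero f = f 0
  ∑ (suc n) f = ∑ n f + f (suc n)

  ∑-cong : ∀ n {f g} → (∀ i → i ≤ n → f i ≡ g i) → ∑ n f ≡ ∑ n g
  ∑-cong zero h = h 0 z≤n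
  ∑-cong (suc n) h = cong₂ _+_ (∑-cong n (λ i i≤n → h i (ℕ.m≤n⇒m≤1+n i≤n))) (h (suc n) ℕ.≤-refl)

  ∑-*ˡ : ∀ n c f → ∑ n (λ i → c * f i) ≡ c * ∑ n f
  ∑-*ˡ zero c f = refl
  ∑-*ˡ (suc n) c f rewrite ∑-*ˡ n c f = sym (ℤ.*-distribˡ-+ c (∑ n f) (f (suc n)))

  ∑-+ : ∀ n f g → ∑ n (λ i → f i + g i) ≡ ∑ n f + ∑ n g
  ∑-+ zero f g = refl
  ∑-+ (suc n) f g rewrite ∑-+ n f g = z (∑ n f) (∑ n g) (f (suc n)) (g (suc n))
    where
    z : ∀ a b c d → a + b + (c + d) ≡ a + c + (b + d)
    z = solve-∀

  ∑-comm : ∀ m n (f : ℕ → ℕ → ℤ) → ∑ m (λ i → ∑ n (f i)) ≡ ∑ n (λ j → ∑ m (λ i → f i j))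
  ∑-comm zero n f = refl
  ∑-comm (suc m) n f rewrite ∑-comm m n f = sym (∑-+ n _ _)

  -- Coefficient sequence of Xᵃ f(X).
  shift : ℕ → (ℕ → ℤ) → ℕ → ℤ
  shift zero    f n       = f n
  shift (suc a) f zero    = + 0
  shift (suc a) f (suc n) = shift a f n

  shift-≥ : ∀ a {f n} j → n ≡ a ℕ.+ j → shift a f n ≡ f j
  shift-≥ zero    j refl = refl
  shift-≥ (suc a) j refl = shift-≥ a j refl

  shift-< : ∀ {a f n} → n < a → shift a f n ≡ + 0
  shift-< {suc a} {n = zero}  _ = refl
  shift-< {suc a} {n = suc n} (s≤s n<a) = shift-< n<a

  -- δ s = (2s − 1)!!, so that (2s)! = 2ˢ δ s s!.
  δ : ℕ → ℤ
  δ zero    = + 1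
  δ (suc s) = + suc (s ℕ.+ s) * δ s

  -- Telescoping certificates: n, k, j are tied by n = 2k + j, respectively
  -- n = k + j, and P, D, E, F stand for the powers, δ (3k + j), e (j + 1) and e k of the summand τ.
  cert₁ : ∀ K J P D E F → let n = K + K + J in
    - (+ 8 * (+ 3 * n + + 2)) * (+ 8 * P * D * E * ((K * F) * (K * F) * (K * F)))
      + ((+ 1 + n) * (+ 1 + n) * (+ 1 + n) * (+ 8 * P * ((+ 1 + ((K + K + K + J) + (K + K + K + J))) * D) * E * (F * F * F))
         - + 8 * ((+ 1 + (n + n)) * (+ 1 + (n + n)) * (+ 1 + (n + n))) * (P * D * ((+ 1 + J) * E) * (F * F * F)))
    ≡ - (+ 8 * (+ 3 * n + + 2)) * (P * ((+ 1 + ((K + K + K + J) + (K + K + K + J))) * D) * (J * ((+ 1 + J) * E)) * (F * F * F))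
  cert₁ = solve-∀

  cert₂ : ∀ K J P D E F → let n = K + J ; s = K + K + K + J in
    - (+ 6 * n + + 5) * (+ 128 * P * D * E * ((K * F) * (K * F) * (K * F)))
      + ((+ 1 + n) * (+ 1 + n) * (+ 1 + n) * (+ 128 * P * ((+ 1 + (s + s)) * D) * E * (F * F * F))
         - + 8 * ((+ 1 + (n + n)) * (+ 1 + (n + n)) * (+ 1 + (n + n))) * (P * D * ((+ 1 + J) * E) * (F * F * F)))
    ≡ - (+ 6 * n + + 5) * (- + 8 * P * ((+ 1 + (+ 1 + s + (+ 1 + s))) * ((+ 1 + (s + s)) * D)) * ((+ 1 + J) * E) * (F * F * F))
  cert₂ = solve-∀

  -- A recurrence in n reads a shifted sequence at both n and n + 1. The middle case is the one
  -- position where only the later of the two entries has begun.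
  split : ∀ a n → suc n < a ⊎ suc n ≡ a ⊎ ∃ λ j → n ≡ a ℕ.+ j
  split a n with ℕ.<-cmp (suc n) a
  ... | tri< lt _ _ = inj₁ lt
  ... | tri≈ _ eq _ = inj₂ (inj₁ eq)
  ... | tri> _ _ (s≤s a≤n) = inj₂ (inj₂ (n ℕ.∸ a , sym (ℕ.m+[n∸m]≡n a≤n)))

  cube : ℤ → ℤ
  cube x = x * x * x

  ∑-telescope : ∀ {D} (G : ℕ → ℤ) M → (∀ k → G k + D k ≡ G (suc k)) → G 0 + ∑ M D ≡ G (suc M)
  ∑-telescope G zero    step = step 0
  ∑-telescope {D} G (suc M) step =
    trans (sym (ℤ.+-assoc (G 0) (∑ M D) _)) (trans (cong (_+ D (suc M)) (∑-telescope {D} G M step)) (step (suc M)))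

  ∑-head : ∀ n f → (∀ i → f (suc i) ≡ + 0) → ∑ n f ≡ f 0
  ∑-head zero    f h = refl
  ∑-head (suc n) f h = trans (cong₂ _+_ (∑-head n f h) (h n)) (ℤ.+-identityʳ (f 0))

  -- Binomial products through factorials and odd products.

  [a+b]Ca*a!*b! : ∀ a b → ((a ℕ.+ b) C a) ℕ.* (a ! ℕ.* b !) ≡ (a ℕ.+ b) !
  [a+b]Ca*a!*b! a b = begin
    ((a ℕ.+ b) C a) ℕ.* (a ! ℕ.* b !)
      ≡⟨ cong (λ c → ((a ℕ.+ b) C a) ℕ.* (a ! ℕ.* c !)) (sym (ℕ.m+n∸m≡n a b)) ⟩
    ((a ℕ.+ b) C a) ℕ.* d
      ≡⟨ cong (ℕ._* d) (nCk≡n!/k![n-k]! a≤) ⟩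
    (((a ℕ.+ b) !) ℕ./ d) ℕ.* d ≡⟨ m/n*n≡m (k![n∸k]!∣n! a≤) ⟩
    (a ℕ.+ b) ! ∎
    where
    open ≡-Reasoning
    a≤ = ℕ.m≤m+n a b
    d = a ! ℕ.* (a ℕ.+ b ℕ.∸ a) !
    instance _ = a !* (a ℕ.+ b ℕ.∸ a) !≢0

  double-! : ∀ s → + ((s ℕ.+ s) !) ≡ (+ 2) ^ s * δ s * + (s !)
  double-! zero = refl
  double-! (suc s) = begin
    + ((suc s ℕ.+ suc s) !) ≡⟨ cong (λ i → + (suc i !)) (ℕ.+-suc s s) ⟩
    + (suc (suc 2s) ℕ.* (suc 2s ℕ.* 2s !)) ≡⟨ ℤ.pos-* (suc (suc 2s)) (suc 2s ℕ.* 2s !) ⟩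
    + suc (suc 2s) * + (suc 2s ℕ.* 2s !) ≡⟨ cong (+ suc (suc 2s) *_) (ℤ.pos-* (suc 2s) (2s !)) ⟩
    + suc (suc 2s) * (+ suc 2s * + (2s !)) ≡⟨ cong (λ x → + suc (suc 2s) * (+ suc 2s * x)) (double-! s) ⟩
    + suc (suc 2s) * (+ suc 2s * ((+ 2) ^ s * δ s * + (s !))) ≡⟨ z (+ s) ((+ 2) ^ s) (δ s) (+ (s !)) ⟩
    + 2 * (+ 2) ^ s * (+ suc 2s * δ s) * (+ suc s * + (s !))
      ≡⟨ cong (+ 2 * (+ 2) ^ s * (+ suc 2s * δ s) *_) (sym (ℤ.pos-* (suc s) (s !))) ⟩
    + 2 * (+ 2) ^ s * (+ suc 2s * δ s) * + (suc s !) ∎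
    where
    open ≡-Reasoning
    2s = s ℕ.+ s
    z : ∀ S P d F → (+ 2 + (S + S)) * ((+ 1 + (S + S)) * (P * d * F)) ≡ + 2 * P * ((+ 1 + (S + S)) * d) * ((+ 1 + S) * F)
    z = solve-∀

  ^-*-distrib : ∀ a b n → (a * b) ^ n ≡ a ^ n * b ^ n
  ^-*-distrib a b zero = refl
  ^-*-distrib a b (suc n) = trans (cong (a * b *_) (^-*-distrib a b n)) (z a b (a ^ n) (b ^ n))
    where
    z : ∀ a b x y → a * b * (x * y) ≡ a * x * (b * y)
    z = solve-∀

  central : ∀ n → + ((2 ℕ.* n) C n) * + (n !) ≡ (+ 2) ^ n * δ n
  central n = ℤ.*-cancelʳ-≡ _ _ (+ (n !)) {{n !≢0}} (begin
    + ((2 ℕ.* n) C n) * + (n !) * + (n !) ≡⟨ ℤ.*-assoc (+ ((2 ℕ.* n) C n)) _ _ ⟩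
    + ((2 ℕ.* n) C n) * (+ (n !) * + (n !)) ≡⟨ cong (+ ((2 ℕ.* n) C n) *_) (sym (ℤ.pos-* (n !) (n !))) ⟩
    + ((2 ℕ.* n) C n) * + (n ! ℕ.* n !) ≡⟨ sym (ℤ.pos-* ((2 ℕ.* n) C n) (n ! ℕ.* n !)) ⟩
    + (((2 ℕ.* n) C n) ℕ.* (n ! ℕ.* n !)) ≡⟨ cong (λ i → + ((i C n) ℕ.* (n ! ℕ.* n !))) (idx n) ⟩
    + (((n ℕ.+ n) C n) ℕ.* (n ! ℕ.* n !)) ≡⟨ cong +_ ([a+b]Ca*a!*b! n n) ⟩
    + ((n ℕ.+ n) !) ≡⟨ double-! n ⟩
    (+ 2) ^ n * δ n * + (n !) ∎)
    where
    open ≡-Reasoning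
    idx : ∀ n → 2 ℕ.* n ≡ n ℕ.+ n
    idx = ℕ-Ring.solve-∀

  central-cube : ∀ n → + (((2 ℕ.* n) C n) ℕ.^ 3) * cube (+ (n !)) ≡ (+ 8) ^ n * cube (δ n)
  central-cube n = begin
    + (c ℕ.^ 3) * cube (+ (n !)) ≡⟨ cong (_* cube (+ (n !))) pos-cube ⟩
    cube (+ c) * cube (+ (n !)) ≡⟨ z (+ c) (+ (n !)) ⟩
    cube (+ c * + (n !)) ≡⟨ cong cube (central n) ⟩
    cube ((+ 2) ^ n * δ n) ≡⟨ sym (z ((+ 2) ^ n) (δ n)) ⟩
    cube ((+ 2) ^ n) * cube (δ n) ≡⟨ cong (_* cube (δ n)) (sym 8^n) ⟩
    (+ 8) ^ n * cube (δ n) ∎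
    where
    open ≡-Reasoning
    c = ((2 ℕ.* n) C n)
    z : ∀ x y → x * x * x * (y * y * y) ≡ (x * y) * (x * y) * (x * y)
    z = solve-∀
    pos-cube : + (c ℕ.^ 3) ≡ cube (+ c)
    pos-cube = trans (cong +_ (w c)) (trans (ℤ.pos-* (c ℕ.* c) c) (cong (_* + c) (ℤ.pos-* c c)))
      where
      w : ∀ c → c ℕ.* (c ℕ.* (c ℕ.* 1)) ≡ c ℕ.* c ℕ.* c
      w = ℕ-Ring.solve-∀
    8^n : (+ 8) ^ n ≡ cube ((+ 2) ^ n)
    8^n = trans (^-*-distrib (+ 4) (+ 2) n) (cong (_* (+ 2) ^ n) (^-*-distrib (+ 2) (+ 2) n))

  sextic : ℕ → ℕ
  sextic k = ((2 ℕ.* k) C k) ℕ.* ((3 ℕ.* k) C k) ℕ.* ((6 ℕ.* k) C (3 ℕ.* k))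

  -- The three binomials collapse to (6k)! / ((3k)! k!³), and `double-!` at 3k replaces (6k)! /
  -- (3k)! by 2^(3k) δ(3k).
  sextic*k!³ : ∀ k → + sextic k * cube (+ (k !)) ≡ (+ 8) ^ k * δ (k ℕ.+ k ℕ.+ k)
  sextic*k!³ k = ℤ.*-cancelʳ-≡ _ _ (+ (s !)) {{s !≢0}} (begin
    + sextic k * cube (+ (k !)) * + (s !) ≡⟨ cong (_* + (s !)) (sym (trans (ℤ.pos-* (sextic k) (k ! ℕ.* k ! ℕ.* k !))
         (cong (+ sextic k *_) (trans (ℤ.pos-* (k ! ℕ.* k !) (k !)) (cong (_* + (k !)) (ℤ.pos-* (k !) (k !))))))) ⟩
    + (sextic k ℕ.* (k ! ℕ.* k ! ℕ.* k !)) * + (s !) ≡⟨ sym (ℤ.pos-* (sextic k ℕ.* (k ! ℕ.* k ! ℕ.* k !)) (s !)) ⟩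
    + (sextic k ℕ.* (k ! ℕ.* k ! ℕ.* k !) ℕ.* s !) ≡⟨ cong +_ nat ⟩
    + ((s ℕ.+ s) !) ≡⟨ double-! s ⟩
    (+ 2) ^ s * δ s * + (s !) ≡⟨ cong (λ x → x * δ s * + (s !)) (sym 8^k) ⟩
    (+ 8) ^ k * δ s * + (s !) ∎)
    where
    open ≡-Reasoning
    s = k ℕ.+ k ℕ.+ k
    8^k : (+ 8) ^ k ≡ (+ 2) ^ s
    8^k = begin
      (+ 8) ^ k ≡⟨ ^-*-distrib (+ 4) (+ 2) k ⟩
      (+ 4) ^ k * (+ 2) ^ k ≡⟨ cong (_* (+ 2) ^ k) (trans (^-*-distrib (+ 2) (+ 2) k) (sym (ℤ.^-distribˡ-+-* (+ 2) k k))) ⟩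
      (+ 2) ^ (k ℕ.+ k) * (+ 2) ^ k ≡⟨ sym (ℤ.^-distribˡ-+-* (+ 2) (k ℕ.+ k) k) ⟩
      (+ 2) ^ s ∎
    nat : sextic k ℕ.* (k ! ℕ.* k ! ℕ.* k !) ℕ.* s ! ≡ (s ℕ.+ s) !
    nat = begin
      sextic k ℕ.* (k ! ℕ.* k ! ℕ.* k !) ℕ.* s !
        ≡⟨ z ((2 ℕ.* k) C k) ((3 ℕ.* k) C k) ((6 ℕ.* k) C (3 ℕ.* k)) (k !) (s !) ⟩
      ((6 ℕ.* k) C (3 ℕ.* k)) ℕ.* ((((3 ℕ.* k) C k) ℕ.* (k ! ℕ.* (((2 ℕ.* k) C k) ℕ.* (k ! ℕ.* k !)))) ℕ.* s !)
        ≡⟨ cong (λ x → ((6 ℕ.* k) C (3 ℕ.* k)) ℕ.* ((((3 ℕ.* k) C k) ℕ.* (k ! ℕ.* x)) ℕ.* s !))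
             (trans (cong (λ i → (i C k) ℕ.* (k ! ℕ.* k !)) (i₂ k)) ([a+b]Ca*a!*b! k k)) ⟩
      ((6 ℕ.* k) C (3 ℕ.* k)) ℕ.* ((((3 ℕ.* k) C k) ℕ.* (k ! ℕ.* (k ℕ.+ k) !)) ℕ.* s !)
        ≡⟨ cong (λ x → ((6 ℕ.* k) C (3 ℕ.* k)) ℕ.* (x ℕ.* s !))
             (trans (cong (λ i → (i C k) ℕ.* (k ! ℕ.* (k ℕ.+ k) !)) (i₃ k))
               (trans ([a+b]Ca*a!*b! k (k ℕ.+ k)) (cong _! (sym (ℕ.+-assoc k k k))))) ⟩
      ((6 ℕ.* k) C (3 ℕ.* k)) ℕ.* (s ! ℕ.* s !)
        ≡⟨ cong₂ (λ i j → (i C j) ℕ.* (s ! ℕ.* s !)) (i₆ k) (i₃′ k) ⟩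
      ((s ℕ.+ s) C s) ℕ.* (s ! ℕ.* s !) ≡⟨ [a+b]Ca*a!*b! s s ⟩
      (s ℕ.+ s) ! ∎
      where
      z : ∀ a b c f g → a ℕ.* b ℕ.* c ℕ.* (f ℕ.* f ℕ.* f) ℕ.* g ≡ c ℕ.* ((b ℕ.* (f ℕ.* (a ℕ.* (f ℕ.* f)))) ℕ.* g)
      z = ℕ-Ring.solve-∀
      i₂ : ∀ k → 2 ℕ.* k ≡ k ℕ.+ k
      i₂ = ℕ-Ring.solve-∀
      i₃ : ∀ k → 3 ℕ.* k ≡ k ℕ.+ (k ℕ.+ k)
      i₃ = ℕ-Ring.solve-∀
      i₃′ : ∀ k → 3 ℕ.* k ≡ k ℕ.+ k ℕ.+ k
      i₃′ = ℕ-Ring.solve-∀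
      i₆ : ∀ k → 6 ℕ.* k ≡ (k ℕ.+ k ℕ.+ k) ℕ.+ (k ℕ.+ k ℕ.+ k)
      i₆ = ℕ-Ring.solve-∀

  -- The two Saalschütz summations over the integers.

  -- The sequence e plays the role of N!/j!, a common multiple of the inverse factorials.
  module Saalschütz (N : ℕ) (e : ℕ → ℤ) (e-step : ∀ j → j < N → e j ≡ + suc j * e (suc j)) where

    -- With `e` = N!/j! this is N!⁴ A^k B^j δ(3k+j) / (j! k!³): the j-th coefficient of the power of
    -- 1 - 2Bx in the k-th term, after N has been replaced by -1/2. The shift by `σ k` then accounts
    -- for the factor x^(σ k).
    τ : ℤ → ℤ → ℕ → ℕ → ℤ
    τ A B k j = A ^ k * B ^ j * δ (k ℕ.+ k ℕ.+ k ℕ.+ j) * e j * cube (e k)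

    -- The operator of the recurrence for C(2n,n)³ applied to the single column k. Each column has a
    -- nonzero defect in general; only the sum over k vanishes.
    defect : (A B : ℤ) (σ : ℕ → ℕ) → ℕ → ℕ → ℤ
    defect A B σ n k = cube (+ suc n) * shift (σ k) (τ A B k) (suc n)
                       - + 8 * cube (+ suc (n ℕ.+ n)) * shift (σ k) (τ A B k) n

    zero-defect : ∀ A B σ n k → suc n < σ k → defect A B σ n k ≡ + 0
    zero-defect A B σ n k lt = begin
      defect A B σ n k ≡⟨ cong₂ (λ x y → cube (+ suc n) * x - + 8 * cube (+ suc (n ℕ.+ n)) * y)
                            (shift-< lt) (shift-< (ℕ.<-trans (ℕ.n<1+n n) lt)) ⟩
      cube (+ suc n) * + 0 - + 8 * cube (+ suc (n ℕ.+ n)) * + 0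
        ≡⟨ z (cube (+ suc n)) (+ 8 * cube (+ suc (n ℕ.+ n))) ⟩
      + 0 ∎
      where
      open ≡-Reasoning
      z : ∀ x y → x * + 0 - y * + 0 ≡ + 0
      z = solve-∀

    -- The coefficients of the x²ᵏ(1 − 16x)^(N−3k).
    module First where
      σ : ℕ → ℕ
      σ k = k ℕ.+ k

      T : ℕ → ℕ → ℤ
      T k = shift (σ k) (τ (+ 8) (+ 8) k)

      -- Where column k has begun, `G n k` is the rational certificate -64 (3n+2) k³ / (n+1-2k)
      -- times `T k n`. At index `suc k` the cube is absorbed by (k+1) e(k+1) = e(k) and the
      -- denominator by `e j`. What remains is an integer sequence that begins one place before
      -- column `suc k`.
      γ : ℕ → ℕ → ℤ
      γ k j = + 8 * ((+ 8) ^ k * (+ 8) ^ j) * δ (2 ℕ.+ (k ℕ.+ k ℕ.+ k ℕ.+ j)) * e j * cube (e k)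

      α : ℕ → ℤ
      α n = - (+ 8 * (+ 3 * + n + + 2))

      G : ℕ → ℕ → ℤ
      G n zero    = + 0
      G n (suc k) = α n * shift (suc (σ k)) (γ k) n

      G≡ : ∀ k j → suc (k ℕ.+ k ℕ.+ j) ≤ N → let n = k ℕ.+ k ℕ.+ j in
        G n k ≡ α n * (+ 8 * ((+ 8) ^ k * (+ 8) ^ j) * δ (k ℕ.+ k ℕ.+ k ℕ.+ j) * e (suc j) * cube (+ k * e k))
      G≡ zero j _ = z (α j) (+ 8 * (+ 1 * (+ 8) ^ j) * δ j * e (suc j)) (e 0)
        where
        z : ∀ x y F → + 0 ≡ x * (y * ((+ 0 * F) * (+ 0 * F) * (+ 0 * F)))
        z = solve-∀
      G≡ (suc k) j h = cong (α (suc k ℕ.+ suc k ℕ.+ j) *_) (begin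
        shift (suc (σ k)) (γ k) (suc k ℕ.+ suc k ℕ.+ j) ≡⟨ shift-≥ (suc (σ k)) (suc j) (idx k j) ⟩
        + 8 * ((+ 8) ^ k * (+ 8 * (+ 8) ^ j)) * δ (2 ℕ.+ (k ℕ.+ k ℕ.+ k ℕ.+ suc j)) * e (suc j) * cube (e k)
          ≡⟨ cong₂ (λ d f → + 8 * ((+ 8) ^ k * (+ 8 * (+ 8) ^ j)) * d * e (suc j) * cube f)
               (cong δ (idx′ k j)) (e-step k k<N) ⟩
        + 8 * ((+ 8) ^ k * (+ 8 * (+ 8) ^ j)) * d * e (suc j) * cube (+ suc k * e (suc k))
          ≡⟨ z ((+ 8) ^ k) ((+ 8) ^ j) d (e (suc j)) (cube (+ suc k * e (suc k))) ⟩
        + 8 * (+ 8 * (+ 8) ^ k * (+ 8) ^ j) * d * e (suc j) * cube (+ suc k * e (suc k)) ∎)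
        where
        open ≡-Reasoning
        d = δ (suc k ℕ.+ suc k ℕ.+ suc k ℕ.+ j)
        idx : ∀ k j → suc k ℕ.+ suc k ℕ.+ j ≡ suc (k ℕ.+ k) ℕ.+ suc j
        idx = ℕ-Ring.solve-∀
        idx′ : ∀ k j → 2 ℕ.+ (k ℕ.+ k ℕ.+ k ℕ.+ suc j) ≡ suc k ℕ.+ suc k ℕ.+ suc k ℕ.+ j
        idx′ = ℕ-Ring.solve-∀
        k<N : k < N
        k<N = ℕ.≤-trans (ℕ.m≤n⇒m≤1+n (ℕ.≤-trans (ℕ.m≤m+n (suc k) (suc k)) (ℕ.m≤m+n _ j))) h
        z : ∀ a b d E c → + 8 * (a * (+ 8 * b)) * d * E * c ≡ + 8 * (+ 8 * a * b) * d * E * c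
        z = solve-∀

      Gsuc≡ : ∀ k j → suc (k ℕ.+ k ℕ.+ j) ≤ N → let n = k ℕ.+ k ℕ.+ j in
        G n (suc k) ≡ α n * (((+ 8) ^ k * (+ 8) ^ j) * δ (suc (k ℕ.+ k ℕ.+ k ℕ.+ j)) * (+ j * (+ suc j * e (suc j))) * cube (e k))
      -- At j = 0 the sequence `γ k`, shifted by 2k + 1, has not begun; on the right the factor j
      -- vanishes.
      Gsuc≡ k zero h = begin
        α (k ℕ.+ k ℕ.+ 0) * shift (suc (σ k)) (γ k) (k ℕ.+ k ℕ.+ 0)
          ≡⟨ cong (α (k ℕ.+ k ℕ.+ 0) *_) (shift-< (s≤s (ℕ.≤-reflexive (ℕ.+-identityʳ (k ℕ.+ k))))) ⟩
        α (k ℕ.+ k ℕ.+ 0) * + 0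
          ≡⟨ z (α (k ℕ.+ k ℕ.+ 0)) (((+ 8) ^ k * + 1) * δ (suc (k ℕ.+ k ℕ.+ k ℕ.+ 0))) (+ 1 * e 1) (cube (e k)) ⟩
        _ ∎
        where
        open ≡-Reasoning
        z : ∀ a b c d → a * + 0 ≡ a * (b * (+ 0 * c) * d)
        z = solve-∀
      Gsuc≡ k (suc j) h = cong (α (k ℕ.+ k ℕ.+ suc j) *_) (begin
        shift (suc (σ k)) (γ k) (k ℕ.+ k ℕ.+ suc j)
          ≡⟨ shift-≥ (suc (σ k)) j (idx k j) ⟩
        + 8 * ((+ 8) ^ k * (+ 8) ^ j) * δ (2 ℕ.+ (k ℕ.+ k ℕ.+ k ℕ.+ j)) * e j * cube (e k)
          ≡⟨ cong₂ (λ d f → + 8 * ((+ 8) ^ k * (+ 8) ^ j) * d * f * cube (e k))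
               (cong δ (idx′ k j))
               (trans (e-step j j<N) (cong (+ suc j *_) (e-step (suc j) sj<N))) ⟩
        + 8 * ((+ 8) ^ k * (+ 8) ^ j) * d * (+ suc j * (+ suc (suc j) * e (suc (suc j)))) * cube (e k)
          ≡⟨ z ((+ 8) ^ k) ((+ 8) ^ j) d _ (cube (e k)) ⟩
        _ ∎)
        where
        open ≡-Reasoning
        d = δ (suc (k ℕ.+ k ℕ.+ k ℕ.+ suc j))
        idx : ∀ k j → k ℕ.+ k ℕ.+ suc j ≡ suc (k ℕ.+ k) ℕ.+ j
        idx = ℕ-Ring.solve-∀
        idx′ : ∀ k j → 2 ℕ.+ (k ℕ.+ k ℕ.+ k ℕ.+ j) ≡ suc (k ℕ.+ k ℕ.+ k ℕ.+ suc j)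
        idx′ = ℕ-Ring.solve-∀
        sj<N : suc j < N
        sj<N = ℕ.≤-trans (s≤s (ℕ.m≤n+m (suc j) (k ℕ.+ k))) h
        j<N : j < N
        j<N = ℕ.<-trans (ℕ.n<1+n j) sj<N
        z : ∀ a b d E c → + 8 * (a * b) * d * E * c ≡ a * (+ 8 * b) * d * E * c
        z = solve-∀

      interior : ∀ k j → suc (k ℕ.+ k ℕ.+ j) ≤ N → let n = k ℕ.+ k ℕ.+ j in
        G n k + defect (+ 8) (+ 8) σ n k ≡ G n (suc k)
      interior k j h = begin
        G n k + defect (+ 8) (+ 8) σ n k
          ≡⟨ cong₂ _+_ (G≡ k j h) (cong₂ (λ x y → cube (+ suc n) * x - + 8 * cube (+ suc (n ℕ.+ n)) * y) upper lower) ⟩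
        _ ≡⟨ cert₁ (+ k) (+ j) P (δ s) (e (suc j)) (e k) ⟩
        α n * (P * δ (suc s) * (+ j * (+ suc j * e (suc j))) * cube (e k))
          ≡⟨ sym (Gsuc≡ k j h) ⟩
        G n (suc k) ∎
        where
        open ≡-Reasoning
        n = k ℕ.+ k ℕ.+ j
        s = k ℕ.+ k ℕ.+ k ℕ.+ j
        P = (+ 8) ^ k * (+ 8) ^ j
        j<N : j < N
        j<N = ℕ.≤-trans (s≤s (ℕ.m≤n+m j (k ℕ.+ k))) h
        lower : T k n ≡ P * δ s * (+ suc j * e (suc j)) * cube (e k)
        lower = trans (shift-≥ (σ k) j refl) (cong (λ x → P * δ s * x * cube (e k)) (e-step j j<N))
        z : ∀ a b → a * (+ 8 * b) ≡ + 8 * (a * b)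
        z = solve-∀
        upper : T k (suc n) ≡ + 8 * P * δ (suc s) * e (suc j) * cube (e k)
        upper = trans (shift-≥ (σ k) (suc j) (sym (ℕ.+-suc (k ℕ.+ k) j)))
          (cong₂ (λ x y → x * y * e (suc j) * cube (e k)) (z ((+ 8) ^ k) ((+ 8) ^ j)) (cong δ (ℕ.+-suc (k ℕ.+ k ℕ.+ k) j)))

      -- At n + 1 = 2(k+1) the denominator of the certificate for column `suc k` vanishes, so the
      -- generic identity does not apply. The column is still 0 at n, and the first entry of `γ k`
      -- cancels (n+1)³ times the first entry of the column.
      boundary : ∀ k → let n = suc (k ℕ.+ k) in suc n ≤ N → G n (suc k) + defect (+ 8) (+ 8) σ n (suc k) ≡ G n (suc (suc k))
      boundary k h = begin
        α m * shift (suc (σ k)) (γ k) m + defect (+ 8) (+ 8) σ m (suc k)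
          ≡⟨ cong₂ _+_ (cong (α m *_) prev)
               (cong₂ (λ x y → cube (+ suc m) * x - + 8 * cube (+ suc (m ℕ.+ m)) * y) upper
                 (shift-< {suc k ℕ.+ suc k} (ℕ.≤-reflexive (cong suc (sym (ℕ.+-suc k k)))))) ⟩
        _ ≡⟨ cert (+ k) ((+ 8) ^ k) d (e 0) (e (suc k)) (+ 8 * cube (+ suc (m ℕ.+ m))) ⟩
        + 0 ≡⟨ sym (ℤ.*-zeroʳ (α m)) ⟩
        α m * + 0 ≡⟨ cong (α m *_) (sym (shift-< {suc (suc k ℕ.+ suc k)} (ℕ.≤-trans (ℕ.≤-reflexive (cong suc (sym (ℕ.+-suc k k)))) (ℕ.n≤1+n _)))) ⟩
        G m (suc (suc k)) ∎
        where
        open ≡-Reasoning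
        m = suc (k ℕ.+ k)
        d = δ (2 ℕ.+ (k ℕ.+ k ℕ.+ k))
        idx : ∀ k → suc k ℕ.+ suc k ℕ.+ suc k ℕ.+ 0 ≡ 3 ℕ.+ (k ℕ.+ k ℕ.+ k)
        idx = ℕ-Ring.solve-∀
        k<N : k < N
        k<N = ℕ.≤-trans (s≤s (ℕ.≤-trans (ℕ.m≤m+n k k) (ℕ.n≤1+n _))) h
        prev : shift (suc (σ k)) (γ k) m ≡ + 8 * ((+ 8) ^ k * + 1) * d * e 0 * cube (+ suc k * e (suc k))
        prev = trans (shift-≥ (suc (σ k)) 0 (sym (ℕ.+-identityʳ _)))
          (cong₂ (λ x y → + 8 * ((+ 8) ^ k * + 1) * x * e 0 * cube y) (cong (λ i → δ (2 ℕ.+ i)) (ℕ.+-identityʳ (k ℕ.+ k ℕ.+ k))) (e-step k k<N))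
        upper : shift (suc k ℕ.+ suc k) (τ (+ 8) (+ 8) (suc k)) (suc m)
          ≡ + 8 * (+ 8) ^ k * + 1 * (+ suc (suc (suc (k ℕ.+ k ℕ.+ k)) ℕ.+ suc (suc (k ℕ.+ k ℕ.+ k))) * d) * e 0 * cube (e (suc k))
        upper = trans (shift-≥ (suc k ℕ.+ suc k) 0 (trans (cong suc (sym (ℕ.+-suc k k))) (sym (ℕ.+-identityʳ _))))
          (cong (λ x → + 8 * (+ 8) ^ k * + 1 * x * e 0 * cube (e (suc k))) (cong δ (idx k)))
        cert : ∀ K P D E F c → - (+ 8 * (+ 3 * (+ 1 + (K + K)) + + 2))
            * (+ 8 * (P * + 1) * D * E * (((+ 1 + K) * F) * ((+ 1 + K) * F) * ((+ 1 + K) * F)))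
          + ((+ 1 + (+ 1 + (K + K))) * (+ 1 + (+ 1 + (K + K))) * (+ 1 + (+ 1 + (K + K)))
              * (+ 8 * P * + 1 * ((+ 1 + ((+ 2 + (K + K + K)) + (+ 2 + (K + K + K)))) * D) * E * (F * F * F)) - c * + 0) ≡ + 0
        cert = solve-∀

      step : ∀ n → suc n ≤ N → ∀ k → G n k + defect (+ 8) (+ 8) σ n k ≡ G n (suc k)
      step n h k with split (σ k) n
      step n h k | inj₂ (inj₂ (j , refl)) = interior k j h
      step n h (suc k) | inj₂ (inj₁ eq) with refl ← trans (ℕ.suc-injective eq) (ℕ.+-suc k k) = boundary k h
      step n h (suc k) | inj₁ lt = begin
        α n * shift (suc (σ k)) (γ k) n + defect (+ 8) (+ 8) σ n (suc k)
          ≡⟨ cong₂ (λ x y → α n * x + y) (shift-< n<) (zero-defect (+ 8) (+ 8) σ n (suc k) lt) ⟩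
        α n * + 0 + + 0 ≡⟨ ℤ.+-identityʳ _ ⟩
        α n * + 0 ≡⟨ cong (α n *_) (sym (shift-< (ℕ.<-trans (ℕ.n<1+n n) (ℕ.<-trans lt (ℕ.n<1+n _))))) ⟩
        G n (suc (suc k)) ∎
        where
        open ≡-Reasoning
        n< : n < suc (σ k)
        n< = ℕ.≤-pred (ℕ.≤-trans lt (ℕ.≤-reflexive (cong suc (ℕ.+-suc k k))))

    -- The coefficients of the (−x)ᵏ(1 − 256x)^(N−3k).
    module Second where
      σ : ℕ → ℕ
      σ k = k

      T : ℕ → ℕ → ℤ
      T k = shift k (τ (- + 8) (+ 128) k)

      -- Here the certificate is -128 (6n+5) k³ / (n+1-k), absorbed into `e` in the same way; column
      -- `suc k` begins at k + 1 and `γ k` is shifted by k.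
      γ : ℕ → ℕ → ℤ
      γ k j = (- + 8) * ((- + 8) ^ k * (+ 128) ^ j) * δ (2 ℕ.+ (k ℕ.+ k ℕ.+ k ℕ.+ j)) * e j * cube (e k)

      α : ℕ → ℤ
      α n = - (+ 6 * + n + + 5)

      G : ℕ → ℕ → ℤ
      G n zero    = + 0
      G n (suc k) = α n * shift k (γ k) n

      G≡ : ∀ k j → suc (k ℕ.+ j) ≤ N → let n = k ℕ.+ j in
        G n k ≡ α n * (+ 128 * ((- + 8) ^ k * (+ 128) ^ j) * δ (k ℕ.+ k ℕ.+ k ℕ.+ j) * e (suc j) * cube (+ k * e k))
      G≡ zero j _ = z (α j) (+ 128 * (+ 1 * (+ 128) ^ j) * δ j * e (suc j)) (e 0)
        where
        z : ∀ x y F → + 0 ≡ x * (y * ((+ 0 * F) * (+ 0 * F) * (+ 0 * F)))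
        z = solve-∀
      G≡ (suc k) j h = cong (α (suc k ℕ.+ j) *_) (begin
        shift k (γ k) (suc k ℕ.+ j) ≡⟨ shift-≥ k (suc j) (sym (ℕ.+-suc k j)) ⟩
        (- + 8) * ((- + 8) ^ k * (+ 128 * (+ 128) ^ j)) * δ (2 ℕ.+ (k ℕ.+ k ℕ.+ k ℕ.+ suc j)) * e (suc j) * cube (e k)
          ≡⟨ cong₂ (λ d f → (- + 8) * ((- + 8) ^ k * (+ 128 * (+ 128) ^ j)) * d * e (suc j) * cube f)
               (cong δ (idx k j)) (e-step k k<N) ⟩
        (- + 8) * ((- + 8) ^ k * (+ 128 * (+ 128) ^ j)) * d * e (suc j) * cube (+ suc k * e (suc k))
          ≡⟨ z ((- + 8) ^ k) ((+ 128) ^ j) d (e (suc j)) (cube (+ suc k * e (suc k))) ⟩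
        + 128 * ((- + 8) * (- + 8) ^ k * (+ 128) ^ j) * d * e (suc j) * cube (+ suc k * e (suc k)) ∎)
        where
        open ≡-Reasoning
        d = δ (suc k ℕ.+ suc k ℕ.+ suc k ℕ.+ j)
        idx : ∀ k j → 2 ℕ.+ (k ℕ.+ k ℕ.+ k ℕ.+ suc j) ≡ suc k ℕ.+ suc k ℕ.+ suc k ℕ.+ j
        idx = ℕ-Ring.solve-∀
        k<N : k < N
        k<N = ℕ.≤-trans (ℕ.m≤n⇒m≤1+n (ℕ.m≤m+n (suc k) j)) h
        z : ∀ a b d E c → (- + 8) * (a * (+ 128 * b)) * d * E * c ≡ + 128 * ((- + 8) * a * b) * d * E * c
        z = solve-∀

      Gsuc≡ : ∀ k j → suc (k ℕ.+ j) ≤ N → let n = k ℕ.+ j in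
        G n (suc k) ≡ α n * ((- + 8) * ((- + 8) ^ k * (+ 128) ^ j) * δ (2 ℕ.+ (k ℕ.+ k ℕ.+ k ℕ.+ j)) * (+ suc j * e (suc j)) * cube (e k))
      Gsuc≡ k j h = cong (α (k ℕ.+ j) *_) (trans (shift-≥ k j refl)
        (cong (λ x → (- + 8) * ((- + 8) ^ k * (+ 128) ^ j) * δ (2 ℕ.+ (k ℕ.+ k ℕ.+ k ℕ.+ j)) * x * cube (e k))
          (e-step j (ℕ.≤-trans (s≤s (ℕ.m≤n+m j k)) h))))

      interior : ∀ k j → suc (k ℕ.+ j) ≤ N → let n = k ℕ.+ j in
        G n k + defect (- + 8) (+ 128) σ n k ≡ G n (suc k)
      interior k j h = begin
        G n k + defect (- + 8) (+ 128) σ n k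
          ≡⟨ cong₂ _+_ (G≡ k j h) (cong₂ (λ x y → cube (+ suc n) * x - + 8 * cube (+ suc (n ℕ.+ n)) * y) upper lower) ⟩
        _ ≡⟨ cert₂ (+ k) (+ j) P (δ s) (e (suc j)) (e k) ⟩
        α n * ((- + 8) * P * δ (2 ℕ.+ s) * (+ suc j * e (suc j)) * cube (e k))
          ≡⟨ sym (Gsuc≡ k j h) ⟩
        G n (suc k) ∎
        where
        open ≡-Reasoning
        n = k ℕ.+ j
        s = k ℕ.+ k ℕ.+ k ℕ.+ j
        P = (- + 8) ^ k * (+ 128) ^ j
        j<N : j < N
        j<N = ℕ.≤-trans (s≤s (ℕ.m≤n+m j k)) h
        lower : T k n ≡ P * δ s * (+ suc j * e (suc j)) * cube (e k)
        lower = trans (shift-≥ (σ k) j refl) (cong (λ x → P * δ s * x * cube (e k)) (e-step j j<N))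
        z : ∀ a b → a * (+ 128 * b) ≡ + 128 * (a * b)
        z = solve-∀
        upper : T k (suc n) ≡ + 128 * P * δ (suc s) * e (suc j) * cube (e k)
        upper = trans (shift-≥ k (suc j) (sym (ℕ.+-suc k j)))
          (cong₂ (λ x y → x * y * e (suc j) * cube (e k)) (z ((- + 8) ^ k) ((+ 128) ^ j)) (cong δ (ℕ.+-suc (k ℕ.+ k ℕ.+ k) j)))

      boundary : ∀ n → suc n ≤ N → G n (suc n) + defect (- + 8) (+ 128) σ n (suc n) ≡ G n (suc (suc n))
      boundary n h = begin
        α n * shift n (γ n) n + defect (- + 8) (+ 128) σ n (suc n)
          ≡⟨ cong₂ _+_ (cong (α n *_) prev) (cong₂ (λ x y → cube (+ suc n) * x - + 8 * cube (+ suc (n ℕ.+ n)) * y) upper (shift-< (ℕ.n<1+n n))) ⟩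
        _ ≡⟨ cert (+ n) ((- + 8) ^ n) d (e 0) (e (suc n)) (+ 8 * cube (+ suc (n ℕ.+ n))) ⟩
        + 0 ≡⟨ sym (ℤ.*-zeroʳ (α n)) ⟩
        α n * + 0 ≡⟨ cong (α n *_) (sym (shift-< (ℕ.n<1+n n))) ⟩
        G n (suc (suc n)) ∎
        where
        open ≡-Reasoning
        d = δ (2 ℕ.+ (n ℕ.+ n ℕ.+ n))
        idx : ∀ k → suc k ℕ.+ suc k ℕ.+ suc k ℕ.+ 0 ≡ 3 ℕ.+ (k ℕ.+ k ℕ.+ k)
        idx = ℕ-Ring.solve-∀
        prev : shift n (γ n) n ≡ (- + 8) * ((- + 8) ^ n * + 1) * d * e 0 * cube (+ suc n * e (suc n))
        prev = trans (shift-≥ n 0 (sym (ℕ.+-identityʳ _)))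
          (cong₂ (λ x y → (- + 8) * ((- + 8) ^ n * + 1) * x * e 0 * cube y) (cong (λ i → δ (2 ℕ.+ i)) (ℕ.+-identityʳ (n ℕ.+ n ℕ.+ n))) (e-step n h))
        upper : T (suc n) (suc n)
          ≡ (- + 8) * (- + 8) ^ n * + 1 * (+ suc (suc (suc (n ℕ.+ n ℕ.+ n)) ℕ.+ suc (suc (n ℕ.+ n ℕ.+ n))) * d) * e 0 * cube (e (suc n))
        upper = trans (shift-≥ (suc n) 0 (sym (ℕ.+-identityʳ _)))
          (cong (λ x → (- + 8) * (- + 8) ^ n * + 1 * x * e 0 * cube (e (suc n))) (cong δ (idx n)))
        cert : ∀ K P D E F c → - (+ 6 * K + + 5) * (- + 8 * (P * + 1) * D * E * (((+ 1 + K) * F) * ((+ 1 + K) * F) * ((+ 1 + K) * F)))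
          + ((+ 1 + K) * (+ 1 + K) * (+ 1 + K)
              * (- + 8 * P * + 1 * ((+ 1 + ((+ 2 + (K + K + K)) + (+ 2 + (K + K + K)))) * D) * E * (F * F * F)) - c * + 0) ≡ + 0
        cert = solve-∀

      step : ∀ n → suc n ≤ N → ∀ k → G n k + defect (- + 8) (+ 128) σ n k ≡ G n (suc k)
      step n h k with split k n
      step n h k | inj₂ (inj₂ (j , refl)) = interior k j h
      step n h k | inj₂ (inj₁ refl) = boundary n h
      step n h (suc k) | inj₁ lt@(s≤s n<k) = begin
        α n * shift k (γ k) n + defect (- + 8) (+ 128) σ n (suc k)
          ≡⟨ cong₂ (λ x y → α n * x + y) (shift-< n<k) (zero-defect (- + 8) (+ 128) σ n (suc k) lt) ⟩
        α n * + 0 + + 0 ≡⟨ ℤ.+-identityʳ _ ⟩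
        α n * + 0 ≡⟨ cong (α n *_) (sym (shift-< (ℕ.<-trans n<k (ℕ.n<1+n _)))) ⟩
        G n (suc (suc k)) ∎
        where open ≡-Reasoning

    module ClosedForm (A B : ℤ) (σ : ℕ → ℕ) (σ0 : σ 0 ≡ 0) (σ> : ∀ k → k < σ (suc k))
      (G : ℕ → ℕ → ℤ) (G0 : ∀ n → G n 0 ≡ + 0) (Gend : ∀ n → n < N → G n (suc N) ≡ + 0)
      (step : ∀ n → suc n ≤ N → ∀ k → G n k + defect A B σ n k ≡ G n (suc k)) where

      S : ℕ → ℤ
      S n = ∑ N (λ k → shift (σ k) (τ A B k) n)

      -- Summed over k ≤ N, the telescoping relation leaves only the two end values of `G`, both 0.
      -- The bound n < N keeps every use of `e-step` in its range.
      S-rec : ∀ n → n < N → cube (+ suc n) * S (suc n) ≡ + 8 * cube (+ suc (n ℕ.+ n)) * S n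
      S-rec n n<N = ℤ.i-j≡0⇒i≡j _ _ (begin
        a * S (suc n) - b * S n ≡⟨ cong (λ x → a * S (suc n) + x) (ℤ.neg-distribˡ-* b (S n)) ⟩
        a * S (suc n) + (- b) * S n ≡⟨ cong₂ _+_ (sym (∑-*ˡ N a _)) (sym (∑-*ˡ N (- b) _)) ⟩
        ∑ N (λ k → a * t (suc n) k) + ∑ N (λ k → (- b) * t n k) ≡⟨ sym (∑-+ N _ _) ⟩
        ∑ N (λ k → a * t (suc n) k + (- b) * t n k)
          ≡⟨ ∑-cong N (λ k _ → cong (λ x → a * t (suc n) k + x) (sym (ℤ.neg-distribˡ-* b (t n k)))) ⟩
        ∑ N (defect A B σ n) ≡⟨ sym (ℤ.+-identityˡ _) ⟩
        + 0 + ∑ N (defect A B σ n) ≡⟨ cong (_+ ∑ N (defect A B σ n)) (sym (G0 n)) ⟩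
        G n 0 + ∑ N (defect A B σ n) ≡⟨ ∑-telescope (G n) N (step n n<N) ⟩
        G n (suc N) ≡⟨ Gend n n<N ⟩
        + 0 ∎)
        where
        open ≡-Reasoning
        a = cube (+ suc n)
        b = + 8 * cube (+ suc (n ℕ.+ n))
        t : ℕ → ℕ → ℤ
        t n k = shift (σ k) (τ A B k) n

      w : ℤ
      w = e 0

      S-zero : S 0 ≡ w * cube w
      S-zero = trans (∑-head N _ (λ k → shift-< (ℕ.≤-trans (s≤s z≤n) (σ> k))))
        (trans (cong (λ a → shift a (τ A B 0) 0) σ0) (cong (_* cube w) (ℤ.*-identityˡ w)))

      -- The factor n!³ lets the recurrence be iterated without division: each step contributes 8
      -- (2n+1)³, the growth of 8ⁿ δ(n)³.
      S-closed : ∀ n → n ≤ N → S n * cube (+ (n !)) ≡ w * cube w * ((+ 8) ^ n * cube (δ n))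
      S-closed zero _ = trans (ℤ.*-identityʳ (S 0)) (trans S-zero (sym (ℤ.*-identityʳ _)))
      S-closed (suc n) n<N = begin
        S (suc n) * cube (+ (suc n ℕ.* n !)) ≡⟨ cong (λ x → S (suc n) * cube x) (ℤ.pos-* (suc n) (n !)) ⟩
        S (suc n) * cube (+ suc n * + (n !)) ≡⟨ z₁ (S (suc n)) (+ suc n) (+ (n !)) ⟩
        cube (+ suc n) * S (suc n) * cube (+ (n !)) ≡⟨ cong (_* cube (+ (n !))) (S-rec n n<N) ⟩
        + 8 * cube s * S n * cube (+ (n !)) ≡⟨ ℤ.*-assoc (+ 8 * cube s) (S n) _ ⟩
        + 8 * cube s * (S n * cube (+ (n !))) ≡⟨ cong (+ 8 * cube s *_) (S-closed n (ℕ.<⇒≤ n<N)) ⟩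
        + 8 * cube s * (w * cube w * ((+ 8) ^ n * cube (δ n))) ≡⟨ z₂ s (w * cube w) ((+ 8) ^ n) (δ n) ⟩
        w * cube w * (+ 8 * (+ 8) ^ n * cube (s * δ n)) ∎
        where
        open ≡-Reasoning
        s = + suc (n ℕ.+ n)
        z₁ : ∀ x y z → x * ((y * z) * (y * z) * (y * z)) ≡ y * y * y * x * (z * z * z)
        z₁ = solve-∀
        z₂ : ∀ s W P d → + 8 * (s * s * s) * (W * (P * (d * d * d))) ≡ W * (+ 8 * P * ((s * d) * (s * d) * (s * d)))
        z₂ = solve-∀

      S≡ : ∀ n → n ≤ N → S n ≡ w * cube w * + (((2 ℕ.* n) C n) ℕ.^ 3)
      S≡ n n≤N = ℤ.*-cancelʳ-≡ _ _ (cube (+ (n !))) {{cube≢0}} (begin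
        S n * cube (+ (n !)) ≡⟨ S-closed n n≤N ⟩
        w * cube w * ((+ 8) ^ n * cube (δ n)) ≡⟨ cong (w * cube w *_) (sym (central-cube n)) ⟩
        w * cube w * (+ (((2 ℕ.* n) C n) ℕ.^ 3) * cube (+ (n !))) ≡⟨ sym (ℤ.*-assoc (w * cube w) _ _) ⟩
        w * cube w * + (((2 ℕ.* n) C n) ℕ.^ 3) * cube (+ (n !)) ∎)
        where
        open ≡-Reasoning
        instance _ = n !≢0
        cube≢0 : ℤ.NonZero (cube (+ (n !)))
        cube≢0 = ℤ.i*j≢0 (+ (n !) * + (n !)) (+ (n !)) {{ℤ.i*j≢0 (+ (n !)) (+ (n !))}}

    -- For `e` = N!/j! the constant in front is N!⁴, one N! for each of the four factorials in j!
    -- k!³.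
    sum-closed : ℤ → ℤ → (ℕ → ℕ) → Set
    sum-closed A B σ = ∀ n → n ≤ N →
      ∑ N (λ k → shift (σ k) (τ A B k) n) ≡ e 0 * cube (e 0) * + (((2 ℕ.* n) C n) ℕ.^ 3)

    first-sum : sum-closed (+ 8) (+ 8) First.σ
    first-sum = ClosedForm.S≡ (+ 8) (+ 8) First.σ refl (λ k → s≤s (ℕ.m≤m+n k (suc k))) First.G (λ _ → refl)
      (λ n n<N → trans (cong (First.α n *_) (shift-< (ℕ.<-trans n<N (s≤s (ℕ.m≤m+n N N))))) (ℤ.*-zeroʳ (First.α n)))
      First.step

    second-sum : sum-closed (- + 8) (+ 128) Second.σ
    second-sum = ClosedForm.S≡ (- + 8) (+ 128) Second.σ refl ℕ.n<1+n Second.G (λ _ → refl)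
      (λ n n<N → trans (cong (Second.α n *_) (shift-< n<N)) (ℤ.*-zeroʳ (Second.α n)))
      Second.step

  -- The integers N!/j!.

  [1+j]⋯[j+d] : ℕ → ℕ → ℕ
  [1+j]⋯[j+d] j zero    = 1
  [1+j]⋯[j+d] j (suc d) = suc j ℕ.* [1+j]⋯[j+d] (suc j) d

  infix 8 _!/!_
  -- For j > N the truncated subtraction gives the value 1, so the relations below are stated within
  -- j ≤ N.
  _!/!_ : ℕ → ℕ → ℤ
  N !/! j = + [1+j]⋯[j+d] j (N ℕ.∸ j)

  !/!-step : ∀ N j → j < N → N !/! j ≡ + suc j * (N !/! suc j)
  !/!-step N j j<N = trans (cong (λ d → + [1+j]⋯[j+d] j d) (ℕ.+-∸-assoc 1 j<N))
    (ℤ.pos-* (suc j) ([1+j]⋯[j+d] (suc j) (N ℕ.∸ suc j)))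

  !*!/! : ∀ N j → j ≤ N → + (j !) * (N !/! j) ≡ N !/! 0
  !*!/! N zero    _   = ℤ.*-identityˡ (N !/! 0)
  !*!/! N (suc j) j<N = begin
    + (suc j ℕ.* j !) * (N !/! suc j) ≡⟨ cong (_* (N !/! suc j)) (ℤ.pos-* (suc j) (j !)) ⟩
    + suc j * + (j !) * (N !/! suc j) ≡⟨ z (+ suc j) (+ (j !)) (N !/! suc j) ⟩
    + (j !) * (+ suc j * (N !/! suc j)) ≡⟨ cong (+ (j !) *_) (sym (!/!-step N j j<N)) ⟩
    + (j !) * (N !/! j) ≡⟨ !*!/! N j (ℕ.<⇒≤ j<N) ⟩
    N !/! 0 ∎
    where
    open ≡-Reasoning
    z : ∀ a b c → a * b * c ≡ b * (a * c)
    z = solve-∀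

  -- Congruences of integers.

  module Congruence (P : ℤ) where

    infix 4 _≈_
    -- The explicit quotient turns each compatibility law into a ring identity after matching on
    -- `mod q refl`.
    record _≈_ (a b : ℤ) : Set where
      constructor mod
      field
        quot : ℤ
        eq   : a ≡ b + quot * P

    ≈-reflexive : ∀ {a b} → a ≡ b → a ≈ b
    ≈-reflexive {a} refl = mod (+ 0) (sym (ℤ.+-identityʳ a))

    ≈-refl : ∀ {a} → a ≈ a
    ≈-refl = ≈-reflexive refl

    ≈-sym : ∀ {a b} → a ≈ b → b ≈ a
    ≈-sym {b = b} (mod q refl) = mod (- q) (z b q P)
      where
      z : ∀ b q P → b ≡ b + q * P + (- q) * P
      z = solve-∀

    ≈-trans : ∀ {a b c} → a ≈ b → b ≈ c → a ≈ c
    ≈-trans {c = c} (mod q refl) (mod r refl) = mod (r + q) (z c q r P)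
      where
      z : ∀ c q r P → c + r * P + q * P ≡ c + (r + q) * P
      z = solve-∀

    ≈-setoid : Setoid 0ℓ 0ℓ
    ≈-setoid = record { Carrier = ℤ ; _≈_ = _≈_ ; isEquivalence = record { refl = ≈-refl ; sym = ≈-sym ; trans = ≈-trans } }

    module ≈-Reasoning = Relation.Binary.Reasoning.Setoid ≈-setoid

    +-cong : ∀ {a b c d} → a ≈ b → c ≈ d → a + c ≈ b + d
    +-cong {b = b} {d = d} (mod q refl) (mod r refl) = mod (q + r) (z b d q r P)
      where
      z : ∀ b d q r P → b + q * P + (d + r * P) ≡ b + d + (q + r) * P
      z = solve-∀

    *-cong : ∀ {a b c d} → a ≈ b → c ≈ d → a * c ≈ b * d
    *-cong {b = b} {d = d} (mod q refl) (mod r refl) = mod (q * d + b * r + q * r * P) (z b d q r P)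
      where
      z : ∀ b d q r P → (b + q * P) * (d + r * P) ≡ b * d + (q * d + b * r + q * r * P) * P
      z = solve-∀

    *-congˡ : ∀ c {a b} → a ≈ b → c * a ≈ c * b
    *-congˡ c = *-cong (≈-refl {c})

    *-congʳ : ∀ c {a b} → a ≈ b → a * c ≈ b * c
    *-congʳ c a≈b = *-cong a≈b (≈-refl {c})

    neg-cong : ∀ {a b} → a ≈ b → - a ≈ - b
    neg-cong {b = b} (mod q refl) = mod (- q) (z b q P)
      where
      z : ∀ b q P → - (b + q * P) ≡ - b + (- q) * P
      z = solve-∀

    ^-cong : ∀ {a b} n → a ≈ b → a ^ n ≈ b ^ n
    ^-cong zero    a≈b = ≈-refl
    ^-cong (suc n) a≈b = *-cong a≈b (^-cong n a≈b)

    *-zeroʳ≈ : ∀ a {b} → b ≈ + 0 → a * b ≈ + 0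
    *-zeroʳ≈ a b≈0 = ≈-trans (*-congˡ a b≈0) (≈-reflexive (ℤ.*-zeroʳ a))

    *-zeroˡ≈ : ∀ {a} b → a ≈ + 0 → a * b ≈ + 0
    *-zeroˡ≈ b a≈0 = ≈-trans (*-congʳ b a≈0) (≈-reflexive (ℤ.*-zeroˡ b))

    a-b≈0⇒a≈b : ∀ {a b} → a - b ≈ + 0 → a ≈ b
    a-b≈0⇒a≈b {a} {b} (mod q eq) = mod q (trans (z a b) (trans (cong (_+_ b) eq) (cong (_+_ b) (ℤ.+-identityˡ (q * P)))))
      where
      z : ∀ a b → a ≡ b + (a - b)
      z = solve-∀

    a≈b⇒a-b≈0 : ∀ {a b} → a ≈ b → a - b ≈ + 0
    a≈b⇒a-b≈0 {b = b} a≈b = ≈-trans (+-cong a≈b (≈-refl { - b})) (≈-reflexive (ℤ.+-inverseʳ b))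

    ∑-cong≈ : ∀ n {f g} → (∀ i → i ≤ n → f i ≈ g i) → ∑ n f ≈ ∑ n g
    ∑-cong≈ zero    h = h 0 z≤n
    ∑-cong≈ (suc n) h = +-cong (∑-cong≈ n (λ i i≤n → h i (ℕ.m≤n⇒m≤1+n i≤n))) (h (suc n) ℕ.≤-refl)

    ∑-truncate : ∀ {m n f} → m ℕ.≤′ n → (∀ i → m < i → i ≤ n → f i ≈ + 0) → ∑ n f ≈ ∑ m f
    ∑-truncate ℕ.≤′-refl h = ≈-refl
    ∑-truncate {n = suc n} {f} (ℕ.≤′-step m≤n) h =
      ≈-trans (+-cong (∑-truncate m≤n (λ i m<i i≤n → h i m<i (ℕ.m≤n⇒m≤1+n i≤n))) (h (suc n) (s≤s (ℕ.≤′⇒≤ m≤n)) ℕ.≤-refl))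
              (≈-reflexive (ℤ.+-identityʳ _))

  -- Generating polynomials and the binomial theorem.

  ∑-uncons : ∀ n f → ∑ (suc n) f ≡ f 0 + ∑ n (f ∘ suc)
  ∑-uncons zero    f = refl
  ∑-uncons (suc n) f = trans (cong (_+ f (suc (suc n))) (∑-uncons n f)) (ℤ.+-assoc (f 0) _ _)

  ∑-shift : ∀ x a b f → ∑ (a ℕ.+ b) (λ n → x ^ n * shift a f n) ≡ x ^ a * ∑ b (λ j → x ^ j * f j)
  ∑-shift x zero    b f = sym (ℤ.*-identityˡ _)
  ∑-shift x (suc a) b f = begin
    ∑ (suc (a ℕ.+ b)) (λ n → x ^ n * shift (suc a) f n) ≡⟨ ∑-uncons (a ℕ.+ b) _ ⟩
    + 0 + ∑ (a ℕ.+ b) (λ n → x ^ suc n * shift a f n) ≡⟨ ℤ.+-identityˡ _ ⟩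
    ∑ (a ℕ.+ b) (λ n → x ^ suc n * shift a f n) ≡⟨ ∑-cong (a ℕ.+ b) (λ n _ → ℤ.*-assoc x (x ^ n) _) ⟩
    ∑ (a ℕ.+ b) (λ n → x * (x ^ n * shift a f n)) ≡⟨ ∑-*ˡ (a ℕ.+ b) x _ ⟩
    x * ∑ (a ℕ.+ b) (λ n → x ^ n * shift a f n) ≡⟨ cong (x *_) (∑-shift x a b f) ⟩
    x * (x ^ a * ∑ b (λ j → x ^ j * f j)) ≡⟨ sym (ℤ.*-assoc x (x ^ a) _) ⟩
    x ^ suc a * ∑ b (λ j → x ^ j * f j) ∎
    where open ≡-Reasoning

  pascal : ∀ n k → + (suc n C suc k) ≡ + (n C k) + + (n C suc k)
  pascal n k = cong +_ (sym (nCk+nC[k+1]≡[n+1]C[k+1] n k))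

  -- The slack between M and B is for columns: they are summed up to N - σ k, while the exponent is
  -- N - 3k. The surplus binomials are 0.
  binomial : ∀ y M B → M ≤ B → ∑ B (λ j → + (M C j) * y ^ j) ≡ (+ 1 + y) ^ M
  binomial y zero    B       _ = ∑-head B _ (λ i → trans (cong (λ c → + c * y ^ suc i) (k>n⇒nCk≡0 {0} {suc i} (s≤s z≤n))) (ℤ.*-zeroˡ (y ^ suc i)))
  binomial y (suc M) (suc B) (s≤s M≤B) = begin
    ∑ (suc B) (λ j → + (suc M C j) * y ^ j) ≡⟨ ∑-uncons B _ ⟩
    + 1 + ∑ B (λ j → + (suc M C suc j) * y ^ suc j)
      ≡⟨ cong (λ s → + 1 + s) (trans
           (∑-cong B (λ j _ → trans (cong (_* y ^ suc j) (pascal M j)) (z₁ (+ (M C j)) (+ (M C suc j)) y (y ^ j)))) (∑-+ B _ _)) ⟩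
    + 1 + (∑ B (λ j → y * (+ (M C j) * y ^ j)) + ∑ B (λ j → + (M C suc j) * y ^ suc j))
      ≡⟨ cong (λ s → + 1 + (s + ∑ B (λ j → + (M C suc j) * y ^ suc j))) (trans (∑-*ˡ B y _) (cong (y *_) (binomial y M B M≤B))) ⟩
    + 1 + (y * (+ 1 + y) ^ M + ∑ B (λ j → + (M C suc j) * y ^ suc j))
      ≡⟨ z₂ (y * (+ 1 + y) ^ M) _ ⟩
    y * (+ 1 + y) ^ M + (+ 1 + ∑ B (λ j → + (M C suc j) * y ^ suc j))
      ≡⟨ cong (λ s → y * (+ 1 + y) ^ M + s) (trans (sym (∑-uncons B _)) (binomial y M (suc B) (ℕ.m≤n⇒m≤1+n M≤B))) ⟩
    y * (+ 1 + y) ^ M + (+ 1 + y) ^ M ≡⟨ z₃ y ((+ 1 + y) ^ M) ⟩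
    (+ 1 + y) * (+ 1 + y) ^ M ∎
    where
    open ≡-Reasoning
    z₁ : ∀ a b y Y → (a + b) * (y * Y) ≡ y * (a * Y) + b * (y * Y)
    z₁ = solve-∀
    z₂ : ∀ a b → + 1 + (a + b) ≡ a + (+ 1 + b)
    z₂ = solve-∀
    z₃ : ∀ y a → y * a + a ≡ (+ 1 + y) * a
    z₃ = solve-∀

  -- This is (j+1) C(M,j+1) = (M-j) C(M,j), arranged without a subtraction of naturals so that it
  -- also holds for j > M. It follows from Pascal's rule by induction on M.
  C-absorb : ∀ M j → + suc j * + (M C suc j) + + j * + (M C j) ≡ + M * + (M C j)
  C-absorb zero zero = refl
  C-absorb zero (suc j) rewrite k>n⇒nCk≡0 {0} {suc j} (s≤s z≤n) | k>n⇒nCk≡0 {0} {suc (suc j)} (s≤s z≤n) = z (+ suc (suc j)) (+ suc j)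
    where
    z : ∀ a b → a * + 0 + b * + 0 ≡ + 0 * + 0
    z = solve-∀
  C-absorb (suc M) zero = begin
    + 1 * + (suc M C 1) + + 0 ≡⟨ cong (λ c → + 1 * c + + 0) (pascal M 0) ⟩
    + 1 * (+ 1 + + (M C 1)) + + 0 ≡⟨ z₁ (+ (M C 1)) ⟩
    + 1 + (+ 1 * + (M C 1) + + 0) ≡⟨ cong (λ s → + 1 + s) (C-absorb M 0) ⟩
    + 1 + + M * + 1 ≡⟨ z₂ (+ M) ⟩
    (+ 1 + + M) * + 1 ∎
    where
    open ≡-Reasoning
    z₁ : ∀ c → + 1 * (+ 1 + c) + + 0 ≡ + 1 + (+ 1 * c + + 0)
    z₁ = solve-∀
    z₂ : ∀ c → + 1 + c * + 1 ≡ (+ 1 + c) * + 1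
    z₂ = solve-∀
  C-absorb (suc M) (suc i) = begin
    + suc (suc i) * + (suc M C suc (suc i)) + + suc i * + (suc M C suc i)
      ≡⟨ cong₂ (λ x y → + suc (suc i) * x + + suc i * y) (pascal M (suc i)) (pascal M i) ⟩
    + suc (suc i) * (b + c) + + suc i * (a + b) ≡⟨ z₁ (+ i) a b c ⟩
    (+ suc (suc i) * c + + suc i * b) + b + ((+ suc i * b + + i * a) + a)
      ≡⟨ cong₂ (λ x y → x + b + (y + a)) (C-absorb M (suc i)) (C-absorb M i) ⟩
    + M * b + b + (+ M * a + a) ≡⟨ z₂ (+ M) a b ⟩
    + suc M * (a + b) ≡⟨ cong (+ suc M *_) (sym (pascal M i)) ⟩
    + suc M * + (suc M C suc i) ∎
    where
    open ≡-Reasoning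
    a = + (M C i)
    b = + (M C suc i)
    c = + (M C suc (suc i))
    z₁ : ∀ i a b c → (+ 2 + i) * (b + c) + (+ 1 + i) * (a + b) ≡ ((+ 2 + i) * c + (+ 1 + i) * b) + b + (((+ 1 + i) * b + i * a) + a)
    z₁ = solve-∀
    z₂ : ∀ M a b → M * b + b + (M * a + a) ≡ (+ 1 + M) * (a + b)
    z₂ = solve-∀

  -- Arithmetic modulo a prime, up to Fermat's little theorem.

  module PrimeModulus {p : ℕ} (pr : Prime p) where
    open Congruence (+ p) public

    ≈0⇒∣ : ∀ {a} → a ≈ + 0 → p ∣ ℤ.∣ a ∣
    ≈0⇒∣ {a} (mod q eq) = divides ℤ.∣ q ∣ (trans (cong ℤ.∣_∣ (trans eq (ℤ.+-identityˡ (q * + p)))) (ℤ.abs-* q (+ p)))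

    ∣⇒≈0 : ∀ {a} → p ∣ ℤ.∣ a ∣ → a ≈ + 0
    ∣⇒≈0 {a} p∣a with Signed.∣ᵤ⇒∣ {+ p} {a} p∣a
    ... | Signed.divides q eq = mod q (trans eq (sym (ℤ.+-identityˡ (q * + p))))

    integral : ∀ a b → a * b ≈ + 0 → a ≈ + 0 ⊎ b ≈ + 0
    integral a b ab≈0 with euclidsLemma ℤ.∣ a ∣ ℤ.∣ b ∣ pr (subst (p ∣_) (ℤ.abs-* a b) (≈0⇒∣ ab≈0))
    ... | inj₁ p∣a = inj₁ (∣⇒≈0 p∣a)
    ... | inj₂ p∣b = inj₂ (∣⇒≈0 p∣b)

    *-≉0 : ∀ {a b} → ¬ a ≈ + 0 → ¬ b ≈ + 0 → ¬ a * b ≈ + 0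
    *-≉0 {a} {b} a≉0 b≉0 ab≈0 with integral a b ab≈0
    ... | inj₁ a≈0 = a≉0 a≈0
    ... | inj₂ b≈0 = b≉0 b≈0

    cancel : ∀ {c} a b → ¬ c ≈ + 0 → c * a ≈ c * b → a ≈ b
    cancel {c} a b c≉0 ca≈cb with integral c (a - b) (≈-trans (≈-reflexive (z a b c)) (a≈b⇒a-b≈0 ca≈cb))
      where
      z : ∀ a b c → c * (a - b) ≡ c * a - c * b
      z = solve-∀
    ... | inj₁ c≈0   = ⊥-elim (c≉0 c≈0)
    ... | inj₂ a-b≈0 = a-b≈0⇒a≈b a-b≈0

    <p⇒≉0 : ∀ {n} → suc n < p → ¬ + suc n ≈ + 0
    <p⇒≉0 {n} n<p n≈0 = >⇒∤ n<p (≈0⇒∣ n≈0)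

    1≉0 : ¬ + 1 ≈ + 0
    1≉0 = <p⇒≉0 (nonTrivial⇒n>1 p {{prime⇒nonTrivial pr}})

    [1+j]⋯[j+d]≉0 : ∀ j d → j ℕ.+ d < p → ¬ + [1+j]⋯[j+d] j d ≈ + 0
    [1+j]⋯[j+d]≉0 j zero    _ = 1≉0
    [1+j]⋯[j+d]≉0 j (suc d) h eq =
      *-≉0 (<p⇒≉0 (ℕ.≤-<-trans (s≤s (ℕ.m≤m+n j d)) h′)) ([1+j]⋯[j+d]≉0 (suc j) d h′)
        (≈-trans (≈-reflexive (sym (ℤ.pos-* (suc j) ([1+j]⋯[j+d] (suc j) d)))) eq)
      where
      h′ : suc j ℕ.+ d < p
      h′ = subst (_< p) (ℕ.+-suc j d) h

    -- `C-absorb` at M = p has right side divisible by p, so consecutive values of j C(p,j) are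
    -- negatives of each other modulo p, beginning with 0.
    j*C≈0 : ∀ j → j < p → + j * + (p C j) ≈ + 0
    j*C≈0 zero    _ = ≈-reflexive (ℤ.*-zeroˡ (+ (p C 0)))
    j*C≈0 (suc j) h = begin
      + suc j * + (p C suc j) ≡⟨ z (+ suc j * + (p C suc j)) (+ j * + (p C j)) ⟩
      + suc j * + (p C suc j) + + j * + (p C j) - + j * + (p C j) ≡⟨ cong (_- + j * + (p C j)) (C-absorb p j) ⟩
      + p * + (p C j) - + j * + (p C j)
        ≈⟨ +-cong (*-zeroˡ≈ {+ p} (+ (p C j)) (∣⇒≈0 ∣-refl)) (neg-cong (j*C≈0 j (ℕ.<-trans (ℕ.n<1+n j) h))) ⟩
      + 0 ∎
      where
      open ≈-Reasoning
      z : ∀ a b → a ≡ a + b - b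
      z = solve-∀

    C≈0 : ∀ j → suc j < p → + (p C suc j) ≈ + 0
    C≈0 j j<p = cancel {+ suc j} _ (+ 0) (<p⇒≉0 j<p)
      (≈-trans (j*C≈0 (suc j) j<p) (≈-reflexive (sym (ℤ.*-zeroʳ (+ suc j)))))

    [1+y]^p : ∀ y → (+ 1 + y) ^ p ≈ + 1 + y ^ p
    [1+y]^p y = subst (λ n → (+ 1 + y) ^ n ≈ + 1 + y ^ n) (ℕ.suc-pred p) (begin
      (+ 1 + y) ^ suc q ≡⟨ sym (binomial y (suc q) (suc q) ℕ.≤-refl) ⟩
      ∑ q f + + (suc q C suc q) * y ^ suc q
        ≈⟨ +-cong (∑-truncate (ℕ.z≤′n {q}) mid) (≈-reflexive (trans (cong (λ c → + c * y ^ suc q) (nCn≡1 (suc q))) (ℤ.*-identityˡ (y ^ suc q)))) ⟩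
      + 1 + y ^ suc q ∎)
      where
      open ≈-Reasoning
      instance _ = prime⇒nonZero pr
      q = ℕ.pred p
      f : ℕ → ℤ
      f j = + (suc q C j) * y ^ j
      mid : ∀ i → 0 < i → i ≤ q → f i ≈ + 0
      mid (suc i) _ i<q = *-zeroˡ≈ (y ^ suc i)
        (subst (λ n → + (n C suc i) ≈ + 0) (sym (ℕ.suc-pred p)) (C≈0 i (subst (suc i <_) (ℕ.suc-pred p) (s≤s i<q))))

    -- Naturals are reached by going up from 0 with `[1+y]^p`; negative integers by reading the same
    -- congruence backwards, from 1 + y to y.
    frobenius : ∀ a → a ^ p ≈ a
    frobenius (+ zero)  = ≈-reflexive (subst (λ n → (+ 0) ^ n ≡ + 0) (ℕ.suc-pred p {{prime⇒nonZero pr}}) (ℤ.*-zeroˡ ((+ 0) ^ ℕ.pred p)))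
    frobenius (+ suc n) = ≈-trans ([1+y]^p (+ n)) (+-cong (≈-refl {+ 1}) (frobenius (+ n)))
    frobenius -[1+ n ]  = unsucc -[1+ n ] (prev n)
      where
      unsucc : ∀ y → (+ 1 + y) ^ p ≈ + 1 + y → y ^ p ≈ y
      unsucc y h = a-b≈0⇒a≈b (≈-trans (≈-reflexive (z (y ^ p) y)) (a≈b⇒a-b≈0 (≈-trans (≈-sym ([1+y]^p y)) h)))
        where
        z : ∀ a b → a - b ≡ + 1 + a - (+ 1 + b)
        z = solve-∀
      prev : ∀ n → (+ 1 + -[1+ n ]) ^ p ≈ + 1 + -[1+ n ]
      prev zero    = frobenius (+ 0)
      prev (suc n) = unsucc -[1+ n ] (prev n)

    fermat : ∀ {n} → p ≡ suc n → ∀ a → ¬ a ≈ + 0 → a ^ n ≈ + 1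
    fermat refl a a≉0 = cancel _ _ a≉0 (≈-trans (frobenius a) (≈-reflexive (sym (ℤ.*-identityʳ a))))

  -- From the integer summations to polynomial congruences modulo p = 2N + 1.

  module Transformation (N : ℕ) (pr : Prime (suc (N ℕ.+ N))) where
    open PrimeModulus pr
    open Saalschütz N (N !/!_) (!/!-step N)

    private
      p = suc (N ℕ.+ N)
      e = N !/!_

    w W : ℤ
    w = N !/! 0
    W = w * cube w

    w≉0 : ¬ w ≈ + 0
    w≉0 = [1+j]⋯[j+d]≉0 0 N (s≤s (ℕ.m≤m+n N N))

    W≉0 : ¬ W ≈ + 0
    W≉0 = *-≉0 w≉0 (*-≉0 (*-≉0 w≉0 w≉0) w≉0)

    -- The last factor of δ(N+1) is 2N + 1 = p, and every later odd product contains it.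
    δ≈0 : ∀ d → δ (suc N ℕ.+ d) ≈ + 0
    δ≈0 zero rewrite ℕ.+-identityʳ N = *-zeroˡ≈ {+ p} (δ N) (∣⇒≈0 ∣-refl)
    δ≈0 (suc d) rewrite ℕ.+-suc N d = *-zeroʳ≈ (+ suc (suc (N ℕ.+ d) ℕ.+ suc (N ℕ.+ d))) (δ≈0 d)

    -- N = −1/2 modulo p turns the rising factorial of s + 1/2 into the falling factorial of N − s.
    rising≈falling : ∀ B s M → N ≡ s ℕ.+ M → ∀ j →
      B ^ j * δ (s ℕ.+ j) ≈ δ s * + (j !) * (+ (M C j) * (- (+ 2 * B)) ^ j)
    rising≈falling B s M refl zero = ≈-reflexive (trans (cong (λ i → + 1 * δ i) (ℕ.+-identityʳ s)) (z (δ s)))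
      where
      z : ∀ d → + 1 * d ≡ d * + 1 * (+ 1 * + 1)
      z = solve-∀
    rising≈falling B s M refl (suc j) = begin
      B * B ^ j * δ (s ℕ.+ suc j) ≡⟨ cong (λ i → B * B ^ j * δ i) (ℕ.+-suc s j) ⟩
      B * B ^ j * (c * δ (s ℕ.+ j)) ≡⟨ z₁ B (B ^ j) c (δ (s ℕ.+ j)) ⟩
      B * c * (B ^ j * δ (s ℕ.+ j)) ≈⟨ *-congˡ (B * c) (rising≈falling B s M refl j) ⟩
      B * c * (δ s * + (j !) * (+ (M C j) * y ^ j))
        -- Since c + 2(M - j) = 2(s + M) + 1 is the modulus itself, the quotient is B.
        ≈⟨ *-congʳ (δ s * + (j !) * (+ (M C j) * y ^ j)) {B * c} {y * (+ M - + j)} (mod B (z₂ B (+ s) (+ j) (+ M))) ⟩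
      (- (+ 2 * B)) * (+ M - + j) * (δ s * + (j !) * (+ (M C j) * y ^ j)) ≡⟨ z₃ y (+ M) (+ j) (δ s * + (j !)) (+ (M C j)) (y ^ j) ⟩
      δ s * + (j !) * (y * y ^ j) * (+ M * + (M C j) - + j * + (M C j))
        ≡⟨ cong (λ x → δ s * + (j !) * (y * y ^ j) * (x - + j * + (M C j))) (sym (C-absorb M j)) ⟩
      δ s * + (j !) * (y * y ^ j) * (+ suc j * + (M C suc j) + + j * + (M C j) - + j * + (M C j))
        ≡⟨ z₄ (δ s) (+ (j !)) (y * y ^ j) (+ suc j) (+ (M C suc j)) (+ j * + (M C j)) ⟩
      δ s * (+ suc j * + (j !)) * (+ (M C suc j) * (y * y ^ j))
        ≡⟨ cong (λ x → δ s * x * (+ (M C suc j) * (y * y ^ j))) (sym (ℤ.pos-* (suc j) (j !))) ⟩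
      δ s * + (suc j !) * (+ (M C suc j) * y ^ suc j) ∎
      where
      open ≈-Reasoning
      y = - (+ 2 * B)
      c = + suc (s ℕ.+ j ℕ.+ (s ℕ.+ j))
      z₁ : ∀ B Bj c d → B * Bj * (c * d) ≡ B * c * (Bj * d)
      z₁ = solve-∀
      z₂ : ∀ B s j M → B * (+ 1 + (s + j + (s + j))) ≡ (- (+ 2 * B)) * (M - j) + B * (+ 1 + ((s + M) + (s + M)))
      z₂ = solve-∀
      z₃ : ∀ y M j d C Y → y * (M - j) * (d * (C * Y)) ≡ d * (y * Y) * (M * C - j * C)
      z₃ = solve-∀
      z₄ : ∀ d f Y s C x → d * f * Y * (s * C + x - x) ≡ d * (s * f) * (C * Y)
      z₄ = solve-∀

    -- The j! produced by `rising≈falling` meets `e j`, and the k!³ hidden in 8ᵏ δ(3k) meets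
    -- `cube (e k)`; each pairing yields an N!, which together make up `W`.
    τ≈ : ∀ ε B k j M → N ≡ k ℕ.+ k ℕ.+ k ℕ.+ M → j ≤ N →
      τ (ε * + 8) B k j ≈ W * (ε ^ k * + sextic k) * (+ (M C j) * (- (+ 2 * B)) ^ j)
    τ≈ ε B k j M eq j≤N = begin
      (ε * + 8) ^ k * B ^ j * δ (s ℕ.+ j) * e j * cube (e k)
        ≡⟨ cong (λ x → x * B ^ j * δ (s ℕ.+ j) * e j * cube (e k)) (^-*-distrib ε (+ 8) k) ⟩
      ε ^ k * (+ 8) ^ k * B ^ j * δ (s ℕ.+ j) * e j * cube (e k)
        ≡⟨ z₁ (ε ^ k) ((+ 8) ^ k) (B ^ j) (δ (s ℕ.+ j)) (e j) (e k) ⟩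
      ε ^ k * (+ 8) ^ k * e j * cube (e k) * (B ^ j * δ (s ℕ.+ j))
        ≈⟨ *-congˡ (ε ^ k * (+ 8) ^ k * e j * cube (e k)) (rising≈falling B s M eq j) ⟩
      ε ^ k * (+ 8) ^ k * e j * cube (e k) * (δ s * + (j !) * b)
        ≡⟨ z₂ (ε ^ k) ((+ 8) ^ k) (e j) (e k) (δ s) (+ (j !)) b ⟩
      ε ^ k * ((+ 8) ^ k * δ s) * (+ (j !) * e j) * cube (e k) * b
        ≡⟨ cong₂ (λ x y → ε ^ k * x * y * cube (e k) * b) (sym (sextic*k!³ k)) (!*!/! N j j≤N) ⟩
      ε ^ k * (+ sextic k * cube (+ (k !))) * w * cube (e k) * b
        ≡⟨ z₃ (ε ^ k) (+ sextic k) (+ (k !)) w (e k) b ⟩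
      w * cube (+ (k !) * e k) * (ε ^ k * + sextic k) * b
        ≡⟨ cong (λ x → w * cube x * (ε ^ k * + sextic k) * b) (!*!/! N k k≤N) ⟩
      W * (ε ^ k * + sextic k) * b ∎
      where
      open ≈-Reasoning
      s = k ℕ.+ k ℕ.+ k
      b = + (M C j) * (- (+ 2 * B)) ^ j
      k≤N : k ≤ N
      k≤N = subst (k ≤_) (sym eq) (ℕ.≤-trans (ℕ.m≤n+m k (k ℕ.+ k)) (ℕ.m≤m+n s M))
      z₁ : ∀ E a b d f g → E * a * b * d * f * (g * g * g) ≡ E * a * f * (g * g * g) * (b * d)
      z₁ = solve-∀
      z₂ : ∀ E a f g d h b → E * a * f * (g * g * g) * (d * h * b) ≡ E * (a * d) * (h * f) * (g * g * g) * b
      z₂ = solve-∀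
      z₃ : ∀ E s h w g b → E * (s * (h * h * h)) * w * (g * g * g) * b ≡ w * ((h * g) * (h * g) * (h * g)) * (E * s) * b
      z₃ = solve-∀

    -- Once 3k > N, the odd product δ(3k+j) contains p. This is what cuts the sum off at p/6.
    τ≈0 : ∀ A B k j → N < k ℕ.+ k ℕ.+ k → τ A B k j ≈ + 0
    τ≈0 A B k j N<3k = *-zeroˡ≈ (cube (e k)) (*-zeroˡ≈ (e j) (*-zeroʳ≈ (A ^ k * B ^ j)
      (subst (λ i → δ i ≈ + 0) (trans (sym (ℕ.+-assoc (suc N) (s ℕ.∸ suc N) j)) (cong (ℕ._+ j) (ℕ.m+[n∸m]≡n N<3k))) (δ≈0 (s ℕ.∸ suc N ℕ.+ j)))))
      where s = k ℕ.+ k ℕ.+ k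

    module _ (ε B : ℤ) (σ : ℕ → ℕ) (σ≤ : ∀ k → σ k ≤ k ℕ.+ k ℕ.+ k)
      (closed : sum-closed (ε * + 8) B σ)
      (K : ℕ) (≤K : ∀ k → k ≤ K → k ℕ.+ k ℕ.+ k ≤ N) (>K : ∀ k → K < k → N < k ℕ.+ k ℕ.+ k)
      (x y z : ℤ) (z^k : ∀ k → ε ^ k * x ^ σ k ≡ z ^ k)
      (y*u³≈z : y * cube (+ 1 + - (+ 2 * B) * x) ≈ z) where

      private
        u v : ℤ
        v = - (+ 2 * B)
        u = + 1 + v * x

        T : ℕ → ℕ → ℤ
        T k = shift (σ k) (τ (ε * + 8) B k)

        c : ℕ → ℤ
        c n = + (((2 ℕ.* n) C n) ℕ.^ 3)

      -- The binomial theorem sums the column to a multiple of zᵏ u^(N-3k). The hypothesis y u³ ≈ z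
      -- turns this into yᵏ u^N, so that u^N, later the Legendre symbol, is common to all columns.
      column : ∀ k → k ≤ K → ∑ N (λ n → x ^ n * T k n) ≈ W * (+ sextic k * y ^ k * u ^ N)
      column k k≤K = begin
        ∑ N (λ n → x ^ n * T k n) ≡⟨ cong (λ m → ∑ m (λ n → x ^ n * T k n)) (sym N≡) ⟩
        ∑ (σ k ℕ.+ (N ℕ.∸ σ k)) (λ n → x ^ n * T k n) ≡⟨ ∑-shift x (σ k) (N ℕ.∸ σ k) _ ⟩
        x ^ σ k * ∑ (N ℕ.∸ σ k) (λ j → x ^ j * τ (ε * + 8) B k j)
          ≈⟨ *-congˡ (x ^ σ k) (∑-cong≈ (N ℕ.∸ σ k) (λ j j≤ →
               ≈-trans (*-congˡ (x ^ j) (τ≈ ε B k j M (sym (ℕ.m+[n∸m]≡n 3k≤N)) (ℕ.≤-trans j≤ (ℕ.m∸n≤m N (σ k)))))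
                 (≈-reflexive (trans (z₁ (x ^ j) (W * (ε ^ k * + sextic k)) (+ (M C j)) (v ^ j))
                   (cong (λ t → W * (ε ^ k * + sextic k) * (+ (M C j) * t)) (sym (^-*-distrib v x j))))))) ⟩
        x ^ σ k * ∑ (N ℕ.∸ σ k) (λ j → W * (ε ^ k * + sextic k) * (+ (M C j) * (v * x) ^ j))
          ≡⟨ cong (x ^ σ k *_) (trans (∑-*ˡ (N ℕ.∸ σ k) (W * (ε ^ k * + sextic k)) (λ j → + (M C j) * (v * x) ^ j))
               (cong (W * (ε ^ k * + sextic k) *_) (binomial (v * x) M (N ℕ.∸ σ k) (ℕ.∸-monoʳ-≤ N (σ≤ k))))) ⟩
        x ^ σ k * (W * (ε ^ k * + sextic k) * u ^ M) ≡⟨ z₂ (x ^ σ k) W (ε ^ k) (+ sextic k) (u ^ M) ⟩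
        W * (+ sextic k * (ε ^ k * x ^ σ k) * u ^ M) ≡⟨ cong (λ t → W * (+ sextic k * t * u ^ M)) (z^k k) ⟩
        W * (+ sextic k * z ^ k * u ^ M)
          ≈⟨ *-congˡ W (*-congʳ (u ^ M) (*-congˡ (+ sextic k) (^-cong k (≈-sym y*u³≈z)))) ⟩
        W * (+ sextic k * (y * cube u) ^ k * u ^ M)
          ≡⟨ cong (λ t → W * (+ sextic k * t * u ^ M)) (trans (^-*-distrib y (cube u) k)
               (cong (y ^ k *_) (trans (^-*-distrib (u * u) u k) (cong (_* u ^ k) (^-*-distrib u u k))))) ⟩
        W * (+ sextic k * (y ^ k * cube (u ^ k)) * u ^ M) ≡⟨ z₃ W (+ sextic k) (y ^ k) (u ^ k) (u ^ M) ⟩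
        W * (+ sextic k * y ^ k * (u ^ k * u ^ k * u ^ k * u ^ M))
          ≡⟨ cong (λ t → W * (+ sextic k * y ^ k * t)) u-pow ⟩
        W * (+ sextic k * y ^ k * u ^ N) ∎
        where
        open ≈-Reasoning
        3k≤N = ≤K k k≤K
        M = N ℕ.∸ (k ℕ.+ k ℕ.+ k)
        N≡ : σ k ℕ.+ (N ℕ.∸ σ k) ≡ N
        N≡ = ℕ.m+[n∸m]≡n (ℕ.≤-trans (σ≤ k) 3k≤N)
        u-pow : u ^ k * u ^ k * u ^ k * u ^ M ≡ u ^ N
        u-pow = trans (cong (λ t → t * u ^ k * u ^ M) (sym (ℤ.^-distribˡ-+-* u k k)))
          (trans (cong (_* u ^ M) (sym (ℤ.^-distribˡ-+-* u (k ℕ.+ k) k)))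
          (trans (sym (ℤ.^-distribˡ-+-* u (k ℕ.+ k ℕ.+ k) M)) (cong (u ^_) (ℕ.m+[n∸m]≡n 3k≤N))))
        z₁ : ∀ X a c V → X * (a * (c * V)) ≡ a * (c * (V * X))
        z₁ = solve-∀
        z₂ : ∀ X W E s U → X * (W * (E * s) * U) ≡ W * (s * (E * X) * U)
        z₂ = solve-∀
        z₃ : ∀ W s Y a M → W * (s * (Y * (a * a * a)) * M) ≡ W * (s * Y * (a * a * a * M))
        z₃ = solve-∀

      column≈0 : ∀ k → K < k → ∑ N (λ n → x ^ n * T k n) ≈ + 0
      column≈0 k K<k = ≈-trans (∑-cong≈ N (λ n _ → *-zeroʳ≈ (x ^ n) (T≈0 (σ k) n)))
        (≈-reflexive (∑-zero N))
        where
        T≈0 : ∀ a n → shift a (τ (ε * + 8) B k) n ≈ + 0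
        T≈0 zero    n       = τ≈0 (ε * + 8) B k n (>K k K<k)
        T≈0 (suc a) zero    = ≈-refl
        T≈0 (suc a) (suc n) = T≈0 a n
        ∑-zero : ∀ n → ∑ n (λ _ → + 0) ≡ + 0
        ∑-zero n = ∑-head n (λ _ → + 0) (λ _ → refl)

      -- Multiplied by `W`, each coefficient on the left becomes a sum over k by `closed`; the
      -- double sum is then taken column by column, and `W`, a power of N!, is cancelled.
      transformation : ∑ N (λ n → c n * x ^ n) ≈ u ^ N * ∑ K (λ k → + sextic k * y ^ k)
      transformation = cancel _ _ W≉0 (begin
        W * ∑ N (λ n → c n * x ^ n) ≡⟨ sym (∑-*ˡ N W _) ⟩
        ∑ N (λ n → W * (c n * x ^ n))
          ≡⟨ ∑-cong N (λ n n≤N → trans (z₁ W (c n) (x ^ n)) (trans (cong (x ^ n *_) (sym (closed n n≤N))) (sym (∑-*ˡ N (x ^ n) _)))) ⟩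
        ∑ N (λ n → ∑ N (λ k → x ^ n * T k n)) ≡⟨ ∑-comm N N _ ⟩
        ∑ N (λ k → ∑ N (λ n → x ^ n * T k n)) ≈⟨ ∑-truncate (ℕ.≤⇒≤′ K≤N) (λ k K<k _ → column≈0 k K<k) ⟩
        ∑ K (λ k → ∑ N (λ n → x ^ n * T k n)) ≈⟨ ∑-cong≈ K column ⟩
        ∑ K (λ k → W * (+ sextic k * y ^ k * u ^ N)) ≡⟨ ∑-cong K (λ k _ → z₂ W (+ sextic k * y ^ k) (u ^ N)) ⟩
        ∑ K (λ k → W * u ^ N * (+ sextic k * y ^ k)) ≡⟨ ∑-*ˡ K (W * u ^ N) _ ⟩
        W * u ^ N * ∑ K (λ k → + sextic k * y ^ k) ≡⟨ ℤ.*-assoc W (u ^ N) _ ⟩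
        W * (u ^ N * ∑ K (λ k → + sextic k * y ^ k)) ∎)
        where
        open ≈-Reasoning
        K≤N : K ≤ N
        K≤N = ℕ.≤-trans (ℕ.m≤n+m K (K ℕ.+ K)) (≤K K ℕ.≤-refl)
        z₁ : ∀ W c X → W * (c * X) ≡ X * (W * c)
        z₁ = solve-∀
        z₂ : ∀ W s U → W * (s * U) ≡ W * U * s
        z₂ = solve-∀

  -- Lagrange's bound on roots and Euler's criterion.

  -- Value at x of the monic polynomial whose lower coefficients, constant term first, are given.
  monic : ∀ {d} → Vec ℤ d → ℤ → ℤ
  monic []       x = + 1
  monic (c ∷ cs) x = c + x * monic cs x

  -- Synthetic division by X - r: the intermediate Horner values at r are the coefficients. The
  -- quotient is again monic, so the vector length records its degree.
  quotient : ∀ {d} → Vec ℤ (suc d) → ℤ → Vec ℤ d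
  quotient (c ∷ [])     r = []
  quotient (c ∷ b ∷ cs) r = monic (b ∷ cs) r ∷ quotient (b ∷ cs) r

  monic-quotient : ∀ {d} (cs : Vec ℤ (suc d)) r x → monic cs x - monic cs r ≡ (x - r) * monic (quotient cs r) x
  monic-quotient (c ∷ []) r x = z c r x
    where
    z : ∀ c r x → c + x * + 1 - (c + r * + 1) ≡ (x - r) * + 1
    z = solve-∀
  monic-quotient (c ∷ b ∷ cs) r x = begin
    c + x * f - (c + r * g) ≡⟨ z₁ c r x f g ⟩
    (x - r) * g + x * (f - g) ≡⟨ cong (λ t → (x - r) * g + x * t) (monic-quotient (b ∷ cs) r x) ⟩
    (x - r) * g + x * ((x - r) * q) ≡⟨ z₂ r x g q ⟩
    (x - r) * (g + x * q) ∎
    where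
    open ≡-Reasoning
    f = monic (b ∷ cs) x
    g = monic (b ∷ cs) r
    q = monic (quotient (b ∷ cs) r) x
    z₁ : ∀ c r x f g → c + x * f - (c + r * g) ≡ (x - r) * g + x * (f - g)
    z₁ = solve-∀
    z₂ : ∀ r x g q → (x - r) * g + x * ((x - r) * q) ≡ (x - r) * (g + x * q)
    z₂ = solve-∀

  monic-zeros : ∀ d x → monic (Vec.replicate d (+ 0)) x ≡ x ^ d
  monic-zeros zero    x = refl
  monic-zeros (suc d) x = trans (ℤ.+-identityˡ _) (cong (x *_) (monic-zeros d x))

  module Euler (N : ℕ) (pr : Prime (suc (N ℕ.+ N))) where
    open PrimeModulus pr

    -- Dividing by X - ρ(d+1) lowers the degree, and the remaining points stay roots because there
    -- are no zero divisors modulo p. The descent ends at the constant 1, which has no root.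
    lagrange : ∀ {d} (cs : Vec ℤ d) (ρ : ℕ → ℤ) →
      (∀ {i j} → i < j → j ≤ d → ¬ ρ i ≈ ρ j) → ¬ (∀ i → i ≤ d → monic cs (ρ i) ≈ + 0)
    lagrange []         ρ distinct roots = 1≉0 (roots 0 z≤n)
    lagrange {suc d} cs@(_ ∷ _) ρ distinct roots =
      lagrange (quotient cs r) ρ (λ i<j j≤d → distinct i<j (ℕ.m≤n⇒m≤1+n j≤d)) roots′
      where
      r = ρ (suc d)
      roots′ : ∀ i → i ≤ d → monic (quotient cs r) (ρ i) ≈ + 0
      roots′ i i≤d with integral (ρ i - r) (monic (quotient cs r) (ρ i))
        (≈-trans (≈-reflexive (sym (monic-quotient cs r (ρ i))))
          (a≈b⇒a-b≈0 (≈-trans (roots i (ℕ.m≤n⇒m≤1+n i≤d)) (≈-sym (roots (suc d) ℕ.≤-refl)))))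
      ... | inj₁ eq = ⊥-elim (distinct (s≤s i≤d) ℕ.≤-refl (a-b≈0⇒a≈b eq))
      ... | inj₂ eq = eq

    square-power : ∀ a x → ¬ x ≈ + 0 → x * x ≈ a → a ^ N ≈ + 1
    square-power a x x≉0 x²≈a = begin
      a ^ N ≈⟨ ^-cong N (≈-sym x²≈a) ⟩
      (x * x) ^ N ≡⟨ ^-*-distrib x x N ⟩
      x ^ N * x ^ N ≡⟨ sym (ℤ.^-distribˡ-+-* x N N) ⟩
      x ^ (N ℕ.+ N) ≈⟨ fermat refl x x≉0 ⟩
      + 1 ∎
      where open ≈-Reasoning

    -- (a^N - 1)(a^N + 1) = a^(p-1) - 1 vanishes by Fermat.
    power-±1 : ∀ a → ¬ a ≈ + 0 → a ^ N ≈ + 1 ⊎ a ^ N ≈ - + 1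
    power-±1 a a≉0 = Sum.map a-b≈0⇒a≈b a-b≈0⇒a≈b (integral (b - + 1) (b - - + 1) (begin
      (b - + 1) * (b - - + 1) ≡⟨ z b ⟩
      b * b - + 1 ≡⟨ cong (_- + 1) (sym (ℤ.^-distribˡ-+-* a N N)) ⟩
      a ^ (N ℕ.+ N) - + 1 ≈⟨ a≈b⇒a-b≈0 (fermat {N ℕ.+ N} refl a a≉0) ⟩
      + 0 ∎))
      where
      open ≈-Reasoning
      b = a ^ N
      z : ∀ b → (b - + 1) * (b - - + 1) ≡ b * b - + 1
      z = solve-∀

    squares-distinct : ∀ a b → ¬ a - b ≈ + 0 → ¬ b + a ≈ + 0 → ¬ b * b ≈ a * a
    squares-distinct a b a-b≉0 b+a≉0 eq =
      *-≉0 a-b≉0 b+a≉0 (≈-trans (≈-reflexive (z a b)) (a≈b⇒a-b≈0 (≈-sym eq)))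
      where
      z : ∀ a b → (a - b) * (b + a) ≡ a * a - b * b
      z = solve-∀

    -- Both the sum and the difference of two distinct numbers in 1, ..., N lie strictly between 0
    -- and p.
    suc²-distinct : ∀ {i j} → i < j → j < N → ¬ + suc i * + suc i ≈ + suc j * + suc j
    suc²-distinct {i} {j} i<j j<N = squares-distinct (+ suc j) (+ suc i) d≉0 s≉0
      where
      difference : + suc j - + suc i ≡ + suc (j ℕ.∸ suc i)
      difference = trans (ℤ.⊖-≥ (s≤s (ℕ.<⇒≤ i<j))) (cong +_ (ℕ.+-∸-assoc 1 i<j))
      d≉0 : ¬ + suc j - + suc i ≈ + 0
      d≉0 = subst (λ d → ¬ d ≈ + 0) (sym difference)
        (<p⇒≉0 (s≤s (ℕ.≤-trans (ℕ.≤-<-trans (ℕ.m∸n≤m j (suc i)) j<N) (ℕ.m≤m+n N N))))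
      s≉0 : ¬ + (suc i ℕ.+ suc j) ≈ + 0
      s≉0 = <p⇒≉0 (s≤s (ℕ.+-mono-≤ (ℕ.<-trans i<j j<N) j<N))

    unity-roots-bound : ∀ (ρ : ℕ → ℤ) → (∀ {i j} → i < j → j ≤ N → ¬ ρ i ≈ ρ j) → ¬ (∀ i → i ≤ N → ρ i ^ N ≈ + 1)
    unity-roots-bound ρ distinct roots = lagrange cs ρ
      (λ i<j j≤ → distinct i<j (subst (_ ≤_) N≡ j≤))
      (λ i i≤ → ≈-trans (≈-reflexive (value (ρ i))) (a≈b⇒a-b≈0 (roots i (subst (i ≤_) N≡ i≤))))
      where
      instance
        N≢0 : ℕ.NonZero N
        -- N = 0 would make the prime equal to 1.
        N≢0 = ℕ.≢-nonZero λ where refl → 1≉0 (∣⇒≈0 {+ 1} ∣-refl)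
      d = ℕ.pred N
      N≡ : suc d ≡ N
      N≡ = ℕ.suc-pred N
      cs : Vec ℤ (suc d)
      cs = - + 1 ∷ Vec.replicate d (+ 0)
      value : ∀ x → monic cs x ≡ x ^ N - + 1
      value x = begin
        - + 1 + x * monic (Vec.replicate d (+ 0)) x ≡⟨ cong (λ t → - + 1 + x * t) (monic-zeros d x) ⟩
        - + 1 + x ^ suc d ≡⟨ cong (λ n → - + 1 + x ^ n) N≡ ⟩
        - + 1 + x ^ N ≡⟨ ℤ.+-comm (- + 1) (x ^ N) ⟩
        x ^ N - + 1 ∎
        where open ≡-Reasoning

    -- The squares of 1, …, N are N roots of X^N − 1, so there is no room for a further one.
    nonresidue-power : ∀ a → ¬ a ≈ + 0 → (∀ x → x < suc (N ℕ.+ N) → ¬ + x * + x ≈ a) → a ^ N ≈ - + 1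
    nonresidue-power a a≉0 none = Sum.[ (λ a^N≈1 → ⊥-elim (unity-roots-bound ρ distinct (ρ^N≈1 a^N≈1)))
      , id ]′ (power-±1 a a≉0)
      where
      ρ : ℕ → ℤ
      ρ zero    = a
      ρ (suc i) = + suc i * + suc i
      ρ^N≈1 : a ^ N ≈ + 1 → ∀ i → i ≤ N → ρ i ^ N ≈ + 1
      ρ^N≈1 a^N≈1 zero    _   = a^N≈1
      ρ^N≈1 _     (suc i) i<N = square-power (ρ (suc i)) (+ suc i) (<p⇒≉0 (s≤s (ℕ.≤-trans i<N (ℕ.m≤m+n N N)))) (≈-refl {ρ (suc i)})
      distinct : ∀ {i j} → i < j → j ≤ N → ¬ ρ i ≈ ρ j
      distinct {zero}  {suc j} _         j<N eq = none (suc j) (s≤s (ℕ.≤-trans j<N (ℕ.m≤m+n N N))) (≈-sym eq)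
      distinct {suc i} {suc j} (s≤s i<j) j<N = suc²-distinct {i} {j} i<j j<N

  -- Integers inside the rationals.

  toℚᵘ-ι : ∀ z → toℚᵘ (ℤtoℚ z) ℚᵘ.≃ ℚᵘ.mkℚᵘ z 0
  toℚᵘ-ι z = ℚ.toℚᵘ-fromℚᵘ (ℚᵘ.mkℚᵘ z 0)

  ι-* : ∀ a b → ℤtoℚ (a * b) ≡ ℤtoℚ a ℚ.* ℤtoℚ b
  ι-* a b = ℚ.toℚᵘ-injective (ℚᵘ.≃-trans (toℚᵘ-ι (a * b)) (ℚᵘ.≃-sym
    (ℚᵘ.≃-trans (ℚ.toℚᵘ-homo-* (ℤtoℚ a) (ℤtoℚ b)) (ℚᵘ.*-cong (toℚᵘ-ι a) (toℚᵘ-ι b)))))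

  ι-+ : ∀ a b → ℤtoℚ (a + b) ≡ ℤtoℚ a ℚ.+ ℤtoℚ b
  ι-+ a b = ℚ.toℚᵘ-injective (ℚᵘ.≃-trans (toℚᵘ-ι (a + b)) (ℚᵘ.≃-sym
    (ℚᵘ.≃-trans (ℚ.toℚᵘ-homo-+ (ℤtoℚ a) (ℤtoℚ b)) (ℚᵘ.≃-trans (ℚᵘ.+-cong (toℚᵘ-ι a) (toℚᵘ-ι b)) (ℚᵘ.*≡* (z a b))))))
    where
    z : ∀ a b → (a * + 1 + b * + 1) * + 1 ≡ (a + b) * + 1
    z = solve-∀

  ι-neg : ∀ a → ℤtoℚ (- a) ≡ ℚ.- ℤtoℚ a
  ι-neg a = ℚ.toℚᵘ-injective (ℚᵘ.≃-trans (toℚᵘ-ι (- a)) (ℚᵘ.≃-sym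
    (ℚᵘ.≃-trans (ℚ.toℚᵘ-homo‿- (ℤtoℚ a)) (ℚᵘ.-‿cong (toℚᵘ-ι a)))))

  cross-multiply : ∀ q d n → q ℚ.* ℤtoℚ d ≡ ℤtoℚ n → ↥ q * d ≡ n * ↧ q
  cross-multiply q@record{} d n eq
    with ℚᵘ.≃-trans (ℚᵘ.≃-sym (ℚᵘ.≃-trans (ℚ.toℚᵘ-homo-* q (ℤtoℚ d)) (ℚᵘ.*-congˡ {toℚᵘ q} (toℚᵘ-ι d))))
           (ℚᵘ.≃-trans (ℚᵘ.≃-reflexive (cong toℚᵘ eq)) (toℚᵘ-ι n))
  ... | ℚᵘ.*≡* h = trans (sym (ℤ.*-identityʳ (↥ q * d))) (trans h (cong (n *_) (trans (ℤ.pos-* (↧ₙ q) 1) (ℤ.*-identityʳ (↧ q)))))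

  *-denominator : ∀ q → q ℚ.* ℤtoℚ (↧ q) ≡ ℤtoℚ (↥ q)
  *-denominator q@record{} = ℚ.toℚᵘ-injective (ℚᵘ.≃-trans (ℚ.toℚᵘ-homo-* q (ℤtoℚ (↧ q)))
    (ℚᵘ.≃-trans (ℚᵘ.*-congˡ {toℚᵘ q} (toℚᵘ-ι (↧ q)))
      (ℚᵘ.≃-trans (ℚᵘ.*≡* (trans (ℤ.*-identityʳ (↥ q * ↧ q))
        (cong (↥ q *_) (sym (trans (ℤ.pos-* (↧ₙ q) 1) (ℤ.*-identityʳ (↧ q))))))) (ℚᵘ.≃-sym (toℚᵘ-ι (↥ q))))))

  inv-inverse : ∀ q → q ≢ 0ℚ → inv q ℚ.* q ≡ 1ℚ
  inv-inverse q q≢0 with q ℚ.≟ 0ℚ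
  ... | yes q≡0 = ⊥-elim (q≢0 q≡0)
  ... | no  q≢0 = ℚ.*-inverseˡ q {{ℚ.≢-nonZero q≢0}}

  -- Reduction of p-integral rationals modulo p.

  module Reduction {p : ℕ} (pr : Prime p) where
    open PrimeModulus pr

    -- q ↦ z says that q lies in ℤₚ and is congruent to z.
    infix 4 _↦_
    record _↦_ (q : ℚ) (z : ℤ) : Set where
      field
        {num den}   : ℤ
        den≉0       : ¬ den ≈ + 0
        q*den≡num   : q ℚ.* ℤtoℚ den ≡ ℤtoℚ num
        num≈z*den   : num ≈ z * den
    open _↦_

    inverse : ∀ a → ¬ a ≈ + 0 → ∃ λ b → a * b ≈ + 1
    inverse a a≉0 = a ^ r , fermat (sym p≡) a a≉0
      where
      instance _ = prime⇒nonZero pr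
      r = ℕ.pred (ℕ.pred p)
      p≡ : suc (suc r) ≡ p
      p≡ = trans (cong suc (ℕ.suc-pred (ℕ.pred p) {{ℕ.>-nonZero (ℕ.pred-mono-< (nonTrivial⇒n>1 p {{prime⇒nonTrivial pr}}))}})) (ℕ.suc-pred p)

    ↦-resp : ∀ {q z z′} → q ↦ z → z ≈ z′ → q ↦ z′
    ↦-resp h z≈z′ = record { den≉0 = den≉0 h ; q*den≡num = q*den≡num h ; num≈z*den = ≈-trans (num≈z*den h) (*-congʳ (den h) z≈z′) }

    ι-↦ : ∀ z → ℤtoℚ z ↦ z
    ι-↦ z = record { den≉0 = 1≉0 ; q*den≡num = ℚ.*-identityʳ (ℤtoℚ z) ; num≈z*den = ≈-reflexive (sym (ℤ.*-identityʳ z)) }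

    +-↦ : ∀ {q r a b} → q ↦ a → r ↦ b → q ℚ.+ r ↦ a + b
    +-↦ {q} {r} {a} {b} h k = record
      { den≉0 = *-≉0 (den≉0 h) (den≉0 k)
      ; q*den≡num = begin
          (q ℚ.+ r) ℚ.* ℤtoℚ (d * e) ≡⟨ ℚ.*-distribʳ-+ (ℤtoℚ (d * e)) q r ⟩
          q ℚ.* ℤtoℚ (d * e) ℚ.+ r ℚ.* ℤtoℚ (d * e)
            ≡⟨ cong₂ ℚ._+_ (scale q d e m (q*den≡num h))
                 (trans (cong (λ x → r ℚ.* ℤtoℚ x) (ℤ.*-comm d e)) (scale r e d n (q*den≡num k))) ⟩
          ℤtoℚ (m * e) ℚ.+ ℤtoℚ (n * d) ≡⟨ sym (ι-+ (m * e) (n * d)) ⟩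
          ℤtoℚ (m * e + n * d) ∎
      ; num≈z*den = ≈-trans (+-cong (*-congʳ e (num≈z*den h)) (*-congʳ d (num≈z*den k))) (≈-reflexive (z a b d e))
      }
      where
      open ≡-Reasoning
      d = den h
      e = den k
      m = num h
      n = num k
      scale : ∀ q d e m → q ℚ.* ℤtoℚ d ≡ ℤtoℚ m → q ℚ.* ℤtoℚ (d * e) ≡ ℤtoℚ (m * e)
      scale q d e m eq = begin
        q ℚ.* ℤtoℚ (d * e) ≡⟨ cong (q ℚ.*_) (ι-* d e) ⟩
        q ℚ.* (ℤtoℚ d ℚ.* ℤtoℚ e) ≡⟨ sym (ℚ.*-assoc q (ℤtoℚ d) (ℤtoℚ e)) ⟩
        q ℚ.* ℤtoℚ d ℚ.* ℤtoℚ e ≡⟨ cong (ℚ._* ℤtoℚ e) eq ⟩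
        ℤtoℚ m ℚ.* ℤtoℚ e ≡⟨ sym (ι-* m e) ⟩
        ℤtoℚ (m * e) ∎
      z : ∀ a b d e → a * d * e + b * e * d ≡ (a + b) * (d * e)
      z = solve-∀

    *-↦ : ∀ {q r a b} → q ↦ a → r ↦ b → q ℚ.* r ↦ a * b
    *-↦ {q} {r} {a} {b} h k = record
      { den≉0 = *-≉0 (den≉0 h) (den≉0 k)
      ; q*den≡num = begin
          (q ℚ.* r) ℚ.* ℤtoℚ (den h * den k) ≡⟨ cong ((q ℚ.* r) ℚ.*_) (ι-* (den h) (den k)) ⟩
          (q ℚ.* r) ℚ.* (ℤtoℚ (den h) ℚ.* ℤtoℚ (den k))
            ≡⟨ CommutativeSemigroup.interchange (CommutativeMonoid.commutativeSemigroup ℚ.*-1-commutativeMonoid) q r (ℤtoℚ (den h)) (ℤtoℚ (den k)) ⟩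
          (q ℚ.* ℤtoℚ (den h)) ℚ.* (r ℚ.* ℤtoℚ (den k)) ≡⟨ cong₂ ℚ._*_ (q*den≡num h) (q*den≡num k) ⟩
          ℤtoℚ (num h) ℚ.* ℤtoℚ (num k) ≡⟨ sym (ι-* (num h) (num k)) ⟩
          ℤtoℚ (num h * num k) ∎
      ; num≈z*den = ≈-trans (*-cong (num≈z*den h) (num≈z*den k)) (≈-reflexive (z a b (den h) (den k)))
      }
      where
      open ≡-Reasoning
      z : ∀ a b d e → a * d * (b * e) ≡ a * b * (d * e)
      z = solve-∀

    neg-↦ : ∀ {q a} → q ↦ a → ℚ.- q ↦ - a
    neg-↦ {q} {a} h = record
      { den≉0 = den≉0 h
      ; q*den≡num = trans (sym (ℚ.neg-distribˡ-* q (ℤtoℚ (den h)))) (trans (cong ℚ.-_ (q*den≡num h)) (sym (ι-neg (num h))))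
      ; num≈z*den = ≈-trans (neg-cong (num≈z*den h)) (≈-reflexive (ℤ.neg-distribˡ-* a (den h)))
      }

    -‿↦ : ∀ {q r a b} → q ↦ a → r ↦ b → q ℚ.- r ↦ a - b
    -‿↦ h k = +-↦ h (neg-↦ k)

    pow-↦ : ∀ {q a} → q ↦ a → ∀ n → pow q n ↦ a ^ n
    pow-↦ h zero    = ι-↦ (+ 1)
    pow-↦ h (suc n) = *-↦ h (pow-↦ h n)

    sumTo-↦ : ∀ n {f g} → (∀ i → f i ↦ g i) → sumTo n f ↦ ∑ n g
    sumTo-↦ zero    h = h 0
    sumTo-↦ (suc n) h = +-↦ (sumTo-↦ n h) (h (suc n))

    -- Numerator and denominator change places. The numerator is prime to p because a is a unit,
    -- which also keeps `inv` away from its default value at 0.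
    inv-↦ : ∀ {q} a b → q ↦ a → a * b ≈ + 1 → inv q ↦ b
    inv-↦ {q} a b h ab≈1 = record
      { den≉0 = num≉0
      ; q*den≡num = begin
          inv q ℚ.* ℤtoℚ (num h) ≡⟨ cong (inv q ℚ.*_) (sym (q*den≡num h)) ⟩
          inv q ℚ.* (q ℚ.* ℤtoℚ (den h)) ≡⟨ sym (ℚ.*-assoc (inv q) q (ℤtoℚ (den h))) ⟩
          inv q ℚ.* q ℚ.* ℤtoℚ (den h) ≡⟨ cong (ℚ._* ℤtoℚ (den h)) (inv-inverse q q≢0) ⟩
          1ℚ ℚ.* ℤtoℚ (den h) ≡⟨ ℚ.*-identityˡ (ℤtoℚ (den h)) ⟩
          ℤtoℚ (den h) ∎
      ; num≈z*den = ≈-sym (≈-trans (*-congˡ b (num≈z*den h)) (≈-trans (≈-reflexive (z a b (den h)))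
          (≈-trans (*-congʳ (den h) ab≈1) (≈-reflexive (ℤ.*-identityˡ (den h))))))
      }
      where
      open ≡-Reasoning
      a≉0 : ¬ a ≈ + 0
      a≉0 a≈0 = 1≉0 (≈-trans (≈-sym ab≈1) (*-zeroˡ≈ b a≈0))
      num≉0 : ¬ num h ≈ + 0
      num≉0 eq = *-≉0 a≉0 (den≉0 h) (≈-trans (≈-sym (num≈z*den h)) eq)
      q≢0 : q ≢ 0ℚ
      q≢0 refl = num≉0 (≈-reflexive (trans (sym (ℤ.*-identityʳ (num h)))
        (trans (sym (cross-multiply 0ℚ (den h) (num h) (q*den≡num h))) (ℤ.*-zeroˡ (den h)))))
      z : ∀ a b d → b * (a * d) ≡ a * b * d
      z = solve-∀

    InZp⇒↦ : ∀ {q} → InZp p q → ∃ λ z → q ↦ z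
    InZp⇒↦ {q} q∈Zp = ↥ q * c , record
      { den≉0 = d≉0
      ; q*den≡num = *-denominator q
      ; num≈z*den = ≈-sym (≈-trans (≈-reflexive (z (↥ q) c (↧ q))) (≈-trans (*-congˡ (↥ q) dc≈1) (≈-reflexive (ℤ.*-identityʳ (↥ q)))))
      }
      where
      d≉0 : ¬ ↧ q ≈ + 0
      d≉0 eq = q∈Zp (≈0⇒∣ eq)
      c = proj₁ (inverse (↧ q) d≉0)
      dc≈1 = proj₂ (inverse (↧ q) d≉0)
      z : ∀ n c d → n * c * d ≡ n * (d * c)
      z = solve-∀

    ↥↧-coprime : ∀ q → ↥ q ≈ + 0 → ¬ ↧ q ≈ + 0
    ↥↧-coprime (mkℚ n d-1 coprime) n≈0 d≈0 =
      Irrelevant.⊥-elim (ℕ.<-irrefl (sym (coprime (≈0⇒∣ n≈0 , ≈0⇒∣ d≈0))) (nonTrivial⇒n>1 p {{prime⇒nonTrivial pr}}))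

    -- `DivZp` inspects the fraction in lowest terms, whereas `q ↦ z` may carry any fraction with
    -- denominator prime to p; cross-multiplication compares the two.
    ≈0⇒DivZp : ∀ {q z} → q ↦ z → z ≈ + 0 → DivZp p q
    ≈0⇒DivZp {q} {z} h z≈0 = Sum.[ ≈0⇒∣ , (λ d≈0 → ⊥-elim (den≉0 h d≈0)) ]′ (integral (↥ q) (den h)
      (≈-trans (≈-reflexive (cross-multiply q (den h) (num h) (q*den≡num h))) (*-zeroˡ≈ (↧ q) (≈-trans (num≈z*den h) (*-zeroˡ≈ (den h) z≈0)))))

    -- In this direction lowest terms matter: p divides the reduced numerator, hence not the reduced
    -- denominator, and so must divide `num h`.
    DivZp⇒≈0 : ∀ {q z} → q ↦ z → DivZp p q → z ≈ + 0
    DivZp⇒≈0 {q} {z} h p∣q = Sum.[ id , (λ d≈0 → ⊥-elim (den≉0 h d≈0)) ]′ (integral z (den h) (≈-trans (≈-sym (num≈z*den h))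
      (Sum.[ id , (λ d≈0 → ⊥-elim (↥↧-coprime q n≈0 d≈0)) ]′ (integral (num h) (↧ q)
        (≈-trans (≈-reflexive (sym (cross-multiply q (den h) (num h) (q*den≡num h)))) (*-zeroˡ≈ (den h) n≈0))))))
      where
      n≈0 : ↥ q ≈ + 0
      n≈0 = ∣⇒≈0 p∣q

    ↦⇒≡[modℚ] : ∀ {q r a b} → q ↦ a → r ↦ b → a ≈ b → q ≡ r [modℚ p ]
    ↦⇒≡[modℚ] h k a≈b = ≈0⇒DivZp (-‿↦ h k) (a≈b⇒a-b≈0 a≈b)

  -- The Legendre symbol and the two reductions.

  data LegendreSpec (a : ℚ) (p : ℕ) : ℤ → Set where
    zero-symbol : DivZp p a → LegendreSpec a p (+ 0)
    residue     : (∃ λ x → DivZp p (ℕtoℚ x ℚ.* ℕtoℚ x ℚ.- a)) → LegendreSpec a p (+ 1)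
    nonresidue  : (∀ x → x < p → ¬ DivZp p (ℕtoℚ x ℚ.* ℕtoℚ x ℚ.- a)) → LegendreSpec a p (- + 1)

  -- The outcomes are recorded in the form Euler's criterion consumes: a square root of any size
  -- gives +1, while -1 comes with the failure of every x < p.
  legendre-spec : ∀ a p → LegendreSpec a p (legendre a p)
  legendre-spec a p with p ∣? ℤ.∣ ↥ a ∣
  ... | yes p∣a = zero-symbol p∣a
  ... | no _ with any? {n = p} (λ (x : Fin p) → p ∣? ℤ.∣ ↥ (ℕtoℚ (toℕ x) ℚ.* ℕtoℚ (toℕ x) ℚ.- a) ∣)
  ...   | yes (x , h) = residue (toℕ x , h)
  ...   | no ∄x       = nonresidue (λ x x<p h → ∄x (fromℕ< x<p ,
            subst (λ y → DivZp p (ℕtoℚ y ℚ.* ℕtoℚ y ℚ.- a)) (sym (toℕ-fromℕ< x<p)) h))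

  odd-prime : ∀ p → Prime p → 3 < p → ∃ λ N → p ≡ suc (N ℕ.+ N)
  odd-prime p pr 3<p with p ℕ.% 2 in eq | m≡m%n+[m/n]*n p 2 | m%n<n p 2
  ... | 0 | p≡ | _ = ⊥-elim (Sum.[ (λ ()) , (λ where refl → ℕ.<-asym 3<p (s≤s (s≤s (s≤s z≤n)))) ]′
                       (prime⇒irreducible pr (divides (p ℕ./ 2) p≡)))
  ... | 1 | p≡ | _ = p ℕ./ 2 , trans p≡ (z (p ℕ./ 2))
    where
    z : ∀ h → 1 ℕ.+ h ℕ.* 2 ≡ suc (h ℕ.+ h)
    z = ℕ-Ring.solve-∀
  ... | suc (suc _) | _ | s≤s (s≤s ())

  centralSum : ℕ → ℚ → ℚ
  centralSum n m = sumTo n (λ k → ℕtoℚ (((2 ℕ.* k) C k) ℕ.^ 3) ℚ.* inv (pow m k))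

  sexticSum : ℕ → ℚ → ℚ
  sexticSum n Y = sumTo n (λ k → ℕtoℚ (sextic k) ℚ.* pow Y k)

  module OddPrime (N : ℕ) (pr : Prime (suc (N ℕ.+ N))) where
    open PrimeModulus pr
    open Saalschütz N (N !/!_) (!/!-step N)
    open Transformation N pr
    open Euler N pr
    open Reduction pr

    private
      p = suc (N ℕ.+ N)

    euler-criterion : ∀ {a A} → a ↦ A → ¬ A ≈ + 0 → legendre a p ≈ A ^ N
    euler-criterion {a} {A} a↦A A≉0 = from-spec (legendre-spec a p)
      where
      x²-a↦ : ∀ x → ℕtoℚ x ℚ.* ℕtoℚ x ℚ.- a ↦ + x * + x - A
      x²-a↦ x = -‿↦ (*-↦ (ι-↦ (+ x)) (ι-↦ (+ x))) a↦A
      from-spec : ∀ {s} → LegendreSpec a p s → s ≈ A ^ N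
      from-spec (zero-symbol p∣a)  = ⊥-elim (A≉0 (DivZp⇒≈0 a↦A p∣a))
      from-spec (residue (x , h))  = ≈-sym (square-power A (+ x) x≉0 x²≈A)
        where
        x²≈A = a-b≈0⇒a≈b (DivZp⇒≈0 (x²-a↦ x) h)
        x≉0 : ¬ + x ≈ + 0
        x≉0 x≈0 = A≉0 (≈-trans (≈-sym x²≈A) (*-zeroˡ≈ (+ x) x≈0))
      from-spec (nonresidue none)  = ≈-sym (nonresidue-power A A≉0 (λ x x<p x²≈A →
        none x x<p (≈0⇒DivZp (x²-a↦ x) (a≈b⇒a-b≈0 x²≈A))))

    -- By parity 6k ≤ 2N + 1 is the same as 3k ≤ N, so the cut at p/6 is exactly where δ(3k) begins
    -- to contain p.
    ≤p/6 : ∀ k → k ≤ p ℕ./ 6 → k ℕ.+ k ℕ.+ k ≤ N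
    ≤p/6 k k≤ = ℕ.≮⇒≥ λ N<3k → ℕ.<⇒≱ (doubled N<3k) (ℕ.≤-trans (ℕ.*-monoˡ-≤ 6 k≤) (m/n*n≤m p 6))
      where
      doubled : N < k ℕ.+ k ℕ.+ k → p < k ℕ.* 6
      doubled N<3k = subst₂ _≤_ (z₁ N) (z₂ k) (ℕ.+-mono-≤ N<3k N<3k)
        where
        z₁ : ∀ N → suc N ℕ.+ suc N ≡ suc (suc (N ℕ.+ N))
        z₁ = ℕ-Ring.solve-∀
        z₂ : ∀ k → (k ℕ.+ k ℕ.+ k) ℕ.+ (k ℕ.+ k ℕ.+ k) ≡ k ℕ.* 6
        z₂ = ℕ-Ring.solve-∀

    >p/6 : ∀ k → p ℕ./ 6 < k → N < k ℕ.+ k ℕ.+ k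
    >p/6 k <k = ℕ.≰⇒> λ 3k≤N → ℕ.<⇒≱ <k (subst (ℕ._≤ p ℕ./ 6) (m*n/n≡m k 6)
      (/-monoˡ-≤ 6 (ℕ.m≤n⇒m≤1+n (subst (ℕ._≤ N ℕ.+ N) (z k) (ℕ.+-mono-≤ 3k≤N 3k≤N)))))
      where
      z : ∀ k → (k ℕ.+ k ℕ.+ k) ℕ.+ (k ℕ.+ k ℕ.+ k) ≡ k ℕ.* 6
      z = ℕ-Ring.solve-∀

    module _ {m : ℚ} {M : ℤ} (m↦M : m ↦ M) (M≉0 : ¬ M ≈ + 0) where

      private
        x : ℤ
        x = proj₁ (inverse M M≉0)
        Mx≈1 : M * x ≈ + 1
        Mx≈1 = proj₂ (inverse M M≉0)

      common : ℤ
      common = ∑ N (λ n → + (((2 ℕ.* n) C n) ℕ.^ 3) * x ^ n)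

      centralSum↦ : centralSum N m ↦ common
      centralSum↦ = sumTo-↦ N λ k → *-↦ (ι-↦ (+ (((2 ℕ.* k) C k) ℕ.^ 3))) (inv-↦ (M ^ k) (x ^ k) (pow-↦ m↦M k) (M^k*x^k≈1 k))
        where
        M^k*x^k≈1 : ∀ k → M ^ k * x ^ k ≈ + 1
        M^k*x^k≈1 k = ≈-trans (≈-reflexive (sym (^-*-distrib M x k))) (≈-trans (^-cong k Mx≈1) (≈-reflexive (ℤ.^-zeroˡ k)))

      1-cx≈x*[M-c] : ∀ c → + 1 + - c * x ≈ x * (M - c)
      1-cx≈x*[M-c] c = ≈-sym (≈-trans (≈-reflexive (z M x c)) (+-cong Mx≈1 (≈-refl { - c * x})))
        where
        z : ∀ M x c → x * (M - c) ≡ M * x + - c * x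
        z = solve-∀

      -- x (M − c) ≡ x² M (M − c) and the square x² does not affect the symbol.
      [1-cx]^N≈legendre : ∀ c → ¬ M - + c ≈ + 0 →
        (+ 1 + - + c * x) ^ N ≈ legendre (m ℚ.* (m ℚ.- ℕtoℚ c)) p
      [1-cx]^N≈legendre c b≉0 = begin
        (+ 1 + - + c * x) ^ N ≈⟨ ^-cong N (≈-trans (1-cx≈x*[M-c] (+ c)) xb≈x²Mb) ⟩
        (x * x * (M * b)) ^ N ≡⟨ ^-*-distrib (x * x) (M * b) N ⟩
        (x * x) ^ N * (M * b) ^ N ≈⟨ *-congʳ ((M * b) ^ N) (square-power (x * x) x x≉0 (≈-refl {x * x})) ⟩
        + 1 * (M * b) ^ N ≡⟨ ℤ.*-identityˡ ((M * b) ^ N) ⟩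
        (M * b) ^ N ≈⟨ ≈-sym (euler-criterion (*-↦ m↦M (-‿↦ m↦M (ι-↦ (+ c)))) (*-≉0 M≉0 b≉0)) ⟩
        legendre (m ℚ.* (m ℚ.- ℕtoℚ c)) p ∎
        where
        open ≈-Reasoning
        b = M - + c
        x≉0 : ¬ x ≈ + 0
        x≉0 x≈0 = 1≉0 (≈-trans (≈-sym Mx≈1) (*-zeroʳ≈ M x≈0))
        z : ∀ x b M → x * x * (M * b) ≡ M * x * (x * b)
        z = solve-∀
        xb≈x²Mb : x * b ≈ x * x * (M * b)
        xb≈x²Mb = ≈-sym (≈-trans (≈-reflexive (z x b M)) (≈-trans (*-congʳ (x * b) Mx≈1) (≈-reflexive (ℤ.*-identityˡ (x * b)))))

      sexticSum↦ : ∀ {Y y} s → Y ↦ y → ℤtoℚ s ℚ.* sexticSum (p ℕ./ 6) Y ↦ s * ∑ (p ℕ./ 6) (λ k → + sextic k * y ^ k)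
      sexticSum↦ s Y↦y = *-↦ (ι-↦ s) (sumTo-↦ (p ℕ./ 6) λ k → *-↦ (ι-↦ (+ sextic k)) (pow-↦ Y↦y k))

      quotient-by-cube : ∀ {q r a b} → q ↦ a → r ↦ b → ¬ b ≈ + 0 →
        ∃ λ y → q ℚ.* inv (pow r 3) ↦ y × y * cube b ≈ a
      quotient-by-cube {a = a} {b} q↦a r↦b b≉0 = a * b′ ^ 3
        , *-↦ q↦a (inv-↦ (b ^ 3) (b′ ^ 3) (pow-↦ r↦b 3) (≈-trans (≈-reflexive (sym (^-*-distrib b b′ 3))) (^-cong 3 bb′≈1)))
        , ≈-trans (≈-reflexive (z a b b′)) (≈-trans (*-congˡ a (*-cong (*-cong bb′≈1 bb′≈1) bb′≈1)) (≈-reflexive (ℤ.*-identityʳ a)))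
        where
        b′ = proj₁ (inverse b b≉0)
        bb′≈1 = proj₂ (inverse b b≉0)
        z : ∀ a b c → a * (c * (c * (c * + 1))) * (b * b * b) ≡ a * ((b * c) * (b * c) * (b * c))
        z = solve-∀

      first-reduction : ¬ M - + 16 ≈ + 0 →
        ℤtoℚ (legendre (m ℚ.* (m ℚ.- ℕtoℚ 16)) p) ℚ.* sexticSum (p ℕ./ 6) (m ℚ.* inv (pow (m ℚ.- ℕtoℚ 16) 3))
          ↦ common
      first-reduction b≉0 = ↦-resp (sexticSum↦ (legendre (m ℚ.* (m ℚ.- ℕtoℚ 16)) p) (proj₁ (proj₂ Y))) (≈-sym
          (≈-trans (transformation (+ 1) (+ 8) First.σ (λ k → ℕ.m≤m+n (k ℕ.+ k) k) first-sum
            (p ℕ./ 6) ≤p/6 >p/6 x y (x * x) 1*x²ᵏ yu³≈x²)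
            (*-congʳ (∑ (p ℕ./ 6) (λ k → + sextic k * y ^ k)) ([1-cx]^N≈legendre 16 b≉0))))
        where
        b = M - + 16
        Y = quotient-by-cube m↦M (-‿↦ m↦M (ι-↦ (+ 16))) b≉0
        y = proj₁ Y
        1*x²ᵏ : ∀ k → (+ 1) ^ k * x ^ (k ℕ.+ k) ≡ (x * x) ^ k
        1*x²ᵏ k = trans (cong₂ _*_ (ℤ.^-zeroˡ k) (ℤ.^-distribˡ-+-* x k k)) (trans (ℤ.*-identityˡ (x ^ k * x ^ k)) (sym (^-*-distrib x x k)))
        u = + 1 + - + 16 * x
        u≈xb : u ≈ x * b
        u≈xb = 1-cx≈x*[M-c] (+ 16)
        yu³≈x² : y * cube u ≈ x * x
        yu³≈x² = begin
          y * cube u ≈⟨ *-congˡ y (*-cong (*-cong u≈xb u≈xb) u≈xb) ⟩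
          y * cube (x * b) ≡⟨ z₁ y x b ⟩
          x * (x * x) * (y * cube b) ≈⟨ *-congˡ (x * (x * x)) (proj₂ (proj₂ Y)) ⟩
          x * (x * x) * M ≡⟨ z₂ x M ⟩
          M * x * (x * x) ≈⟨ *-congʳ (x * x) Mx≈1 ⟩
          + 1 * (x * x) ≡⟨ ℤ.*-identityˡ (x * x) ⟩
          x * x ∎
          where
          open ≈-Reasoning
          z₁ : ∀ y x b → y * ((x * b) * (x * b) * (x * b)) ≡ x * (x * x) * (y * (b * b * b))
          z₁ = solve-∀
          z₂ : ∀ x M → x * (x * x) * M ≡ M * x * (x * x)
          z₂ = solve-∀

      second-reduction : ¬ M - + 256 ≈ + 0 →
        ℤtoℚ (legendre (m ℚ.* (m ℚ.- ℕtoℚ 256)) p) ℚ.* sexticSum (p ℕ./ 6) ((m ℚ.* m) ℚ.* inv (pow (ℕtoℚ 256 ℚ.- m) 3))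
          ↦ common
      second-reduction b≉0 = ↦-resp (sexticSum↦ (legendre (m ℚ.* (m ℚ.- ℕtoℚ 256)) p) (proj₁ (proj₂ Y))) (≈-sym
          (≈-trans (transformation (- + 1) (+ 128) Second.σ (λ k → ℕ.m≤n+m k (k ℕ.+ k)) second-sum
            (p ℕ./ 6) ≤p/6 >p/6 x y (- + 1 * x) (λ k → sym (^-*-distrib (- + 1) x k)) yu³≈-x)
            (*-congʳ (∑ (p ℕ./ 6) (λ k → + sextic k * y ^ k)) ([1-cx]^N≈legendre 256 b≉0))))
        where
        a = + 256 - M
        swap : ∀ c M → c - M ≡ - (M - c)
        swap = solve-∀
        a≉0 : ¬ a ≈ + 0
        a≉0 a≈0 = b≉0 (≈-trans (≈-reflexive (trans (sym (ℤ.neg-involutive (M - + 256))) (cong -_ (sym (swap (+ 256) M))))) (neg-cong a≈0))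
        Y = quotient-by-cube (*-↦ m↦M m↦M) (-‿↦ (ι-↦ (+ 256)) m↦M) a≉0
        y = proj₁ Y
        u = + 1 + - + 256 * x
        z₀ : ∀ x M c → x * (M - c) ≡ - x * (c - M)
        z₀ = solve-∀
        -- The argument has 256 - m where the symbol has m - 256. The resulting sign survives the
        -- cube and gives z = -x, whence ε = -1.
        u≈-xa : u ≈ - x * a
        u≈-xa = ≈-trans (1-cx≈x*[M-c] (+ 256)) (≈-reflexive (z₀ x M (+ 256)))
        yu³≈-x : y * cube u ≈ - + 1 * x
        yu³≈-x = begin
          y * cube u ≈⟨ *-congˡ y (*-cong (*-cong u≈-xa u≈-xa) u≈-xa) ⟩
          y * cube (- x * a) ≡⟨ z₁ y x a ⟩
          - (x * x * x) * (y * cube a) ≈⟨ *-congˡ (- (x * x * x)) (proj₂ (proj₂ Y)) ⟩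
          - (x * x * x) * (M * M) ≡⟨ z₂ x M ⟩
          M * x * (M * x) * (- + 1 * x) ≈⟨ *-congʳ (- + 1 * x) (*-cong Mx≈1 Mx≈1) ⟩
          + 1 * + 1 * (- + 1 * x) ≡⟨ ℤ.*-identityˡ (- + 1 * x) ⟩
          - + 1 * x ∎
          where
          open ≈-Reasoning
          z₁ : ∀ y x a → y * ((- x * a) * (- x * a) * (- x * a)) ≡ - (x * x * x) * (y * (a * a * a))
          z₁ = solve-∀
          z₂ : ∀ x M → - (x * x * x) * (M * M) ≡ M * x * (M * x) * (- + 1 * x)
          z₂ = solve-∀

    -- All three members are sent to one and the same integer, so each of the two congruences
    -- reduces to reflexivity.
    common-reduction : ∀ {m M} → m ↦ M → ¬ DivZp p (m ℚ.* (m ℚ.- ℕtoℚ 16) ℚ.* (m ℚ.- ℕtoℚ 256)) → ∃ λ z →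
      centralSum ((p ℕ.∸ 1) ℕ./ 2) m ↦ z
      × ℤtoℚ (legendre (m ℚ.* (m ℚ.- ℕtoℚ 16)) p) ℚ.* sexticSum (p ℕ./ 6) (m ℚ.* inv (pow (m ℚ.- ℕtoℚ 16) 3)) ↦ z
      × ℤtoℚ (legendre (m ℚ.* (m ℚ.- ℕtoℚ 256)) p) ℚ.* sexticSum (p ℕ./ 6) ((m ℚ.* m) ℚ.* inv (pow (ℕtoℚ 256 ℚ.- m) 3)) ↦ z
    common-reduction {m} {M} m↦M p∤m[m-16][m-256] = common m↦M M≉0
      , subst (λ n → centralSum n m ↦ common m↦M M≉0) (sym half) (centralSum↦ m↦M M≉0)
      , first-reduction m↦M M≉0 (λ b≈0 → product≉0 (*-zeroˡ≈ (M - + 256) (*-zeroʳ≈ M b≈0)))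
      , second-reduction m↦M M≉0 (λ b≈0 → product≉0 (*-zeroʳ≈ (M * (M - + 16)) b≈0))
      where
      product≉0 : ¬ M * (M - + 16) * (M - + 256) ≈ + 0
      product≉0 eq = p∤m[m-16][m-256] (≈0⇒DivZp (*-↦ (*-↦ m↦M (-‿↦ m↦M (ι-↦ (+ 16)))) (-‿↦ m↦M (ι-↦ (+ 256)))) eq)
      M≉0 : ¬ M ≈ + 0
      M≉0 M≈0 = product≉0 (*-zeroˡ≈ (M - + 256) (*-zeroˡ≈ (M - + 16) M≈0))
      z : ∀ N → N ℕ.+ N ≡ N ℕ.* 2
      z = ℕ-Ring.solve-∀
      half : (N ℕ.+ N) ℕ./ 2 ≡ N
      half = trans (cong (ℕ._/ 2) (z N)) (m*n/n≡m N 2)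

open import Defs
open import Data.Nat using (ℕ; _<_; _∸_; _/_)
open import Data.Nat.Combinatorics using (_C_)
open import Data.Nat.Primality using (Prime)
open import Data.Rational using (ℚ; _+_; _*_; _-_)
open import Data.Product using (_×_)
open import Relation.Nullary using (¬_)
open import Data.Product using (_,_; proj₁; proj₂)
open import Relation.Binary.PropositionalEquality using (refl)

theorem2p1 : (p : ℕ) → Prime p → 3 < p → (m : ℚ) → InZp p m →
    ¬ DivZp p (m * (m - ℕtoℚ 16) * (m - ℕtoℚ 256)) →
    (sumTo ((p ∸ 1) / 2) (λ k → ℕtoℚ (((2 Data.Nat.* k) C k) Data.Nat.^ 3) * inv (pow m k))
    ≡ ℤtoℚ (legendre (m * (m - ℕtoℚ 16)) p)
    * sumTo (p / 6) (λ k → ℕtoℚ (((2 Data.Nat.* k) C k) Data.Nat.* ((3 Data.Nat.* k) C k) Data.Nat.* ((6 Data.Nat.* k) C (3 Data.Nat.* k)))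
    * pow (m * inv (pow (m - ℕtoℚ 16) 3)) k) [modℚ p ])
    × (ℤtoℚ (legendre (m * (m - ℕtoℚ 16)) p)
    * sumTo (p / 6) (λ k → ℕtoℚ (((2 Data.Nat.* k) C k) Data.Nat.* ((3 Data.Nat.* k) C k) Data.Nat.* ((6 Data.Nat.* k) C (3 Data.Nat.* k)))
    * pow (m * inv (pow (m - ℕtoℚ 16) 3)) k)
    ≡ ℤtoℚ (legendre (m * (m - ℕtoℚ 256)) p)
    * sumTo (p / 6) (λ k → ℕtoℚ (((2 Data.Nat.* k) C k) Data.Nat.* ((3 Data.Nat.* k) C k) Data.Nat.* ((6 Data.Nat.* k) C (3 Data.Nat.* k)))
    * pow ((m * m) * inv (pow (ℕtoℚ 256 - m) 3)) k) [modℚ p ])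
theorem2p1 p pr 3<p m m∈Zp p∤m[m-16][m-256] with Transformations.odd-prime p pr 3<p
... | N , refl = ↦⇒≡[modℚ] central↦ first↦ ≈-refl , ↦⇒≡[modℚ] first↦ second↦ ≈-refl
  where
  open Transformations.PrimeModulus pr
  open Transformations.Reduction pr
  reductions = Transformations.OddPrime.common-reduction N pr (proj₂ (InZp⇒↦ {m} m∈Zp)) p∤m[m-16][m-256]
  central↦ = proj₁ (proj₂ reductions)
  first↦   = proj₁ (proj₂ (proj₂ reductions))
  second↦  = proj₂ (proj₂ (proj₂ reductions))
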